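{- Let $n,k,d$ be positive integers. The maps $\Phi$ and $\Psi$ (which are mutually inverse bijections between equivalence classes of nondegenerate $[n,k,d]_{q^m/q}$ codes and equivalence classes of $[n,k,d]_{q^m/q}$ systems) restrict to a 1-to-1 correspondence between the equivalence classes of nondegenerate minimal $[n,k,d]_{q^m/q}$ rank-metric codes and the equivalence classes of $[n,k,d]_{q^m/q}$ systems that are linear cutting blocking sets.
   Context: Let $q$ be a prime power and $m$ a positive integer. For $v\in\mathbb{F}_{q^m}^n$ and an ordered basis $\Gamma=(\gamma_1,\dots,\gamma_m)$ of $\mathbb{F}_{q^m}$ over $\mathbb{F}_q$, let $\Gamma(v)\in\mathbb{F}_q^{n\times m}$ be the matrix with $v_i=\sum_{j}\Gamma(v)_{ij}\gamma_j$. The rank support $\sigma^{\mathrm{rk}}(v)\subseteq\mathbb{F}_q^n$ is the column space of $\Gamma(v)$ (independent of $\Gamma$), and $\mathrm{rk}(v)=\dim_{\mathbb{F}_q}\sigma^{\mathrm{rk}}(v)$. An $[n,k,d]_{q^m/q}$ code is a $k$-dimensional $\mathbb{F}_{q^m}$-subspace $\mathcal{C}\subseteq\mathbb{F}_{q^m}^n$ whose nonzero codewords have minimum rank $d$. It is nondegenerate if $\sum_{v\in\mathcal{C}}\sigma^{\mathrm{rk}}(v)=\mathbb{F}_q^n$. Two codes $\mathcal{C},\mathcal{C}'\subseteq\mathbb{F}_{q^m}^n$ are equivalent if $\mathcal{C}'=\{vA:v\in\mathcal{C}\}$ for some $A\in\mathrm{GL}_n(q)$. A code $\mathcal{C}$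 is minimal if for all $v,v'\in\mathcal{C}$, $\sigma^{\mathrm{rk}}(v')\subseteq\sigma^{\mathrm{rk}}(v)$ implies $v'=\alpha v$ for some $\alpha\in\mathbb{F}_{q^m}$. An $[n,k,d]_{q^m/q}$ system is an $n$-dimensional $\mathbb{F}_q$-subspace $\mathcal{U}\subseteq\mathbb{F}_{q^m}^k$ with $\langle\mathcal{U}\rangle_{\mathbb{F}_{q^m}}=\mathbb{F}_{q^m}^k$ and $d=n-\max\{\dim_{\mathbb{F}_q}(\mathcal{U}\cap H): H \text{ an } \mathbb{F}_{q^m}\text{ -hyperplane of } \mathbb{F}_{q^m}^k\}$. Two systems are equivalent if an $\mathbb{F}_{q^m}$-linear automorphism of $\mathbb{F}_{q^m}^k$ maps one to the other. A system $\mathcal{U}$ is a linear cutting blocking set if for all $\mathbb{F}_{q^m}$-hyperplanes $H,H'\subseteq\mathbb{F}_{q^m}^k$, $(\mathcal{U}\cap H)\subseteq(\mathcal{U}\cap H')$ implies $H=H'$. $\Phi$ sends the class of a nondegenerate code $\mathcal{C}$ to the class of the $\mathbb{F}_q$-span in $\mathbb{F}_{q^m}^k$ of the columns of a generator matrix $G\in\mathbb{F}_{q^m}^{k\times n}$ of $\mathcal{C}$. $\Psi$ sends the class of a system $\mathcal{U}$ to the class of the code generated by the rows of the $k\times n$ matrix whose columns form an $\mathbb{F}_q$-basis of $\mathcal{U}$. -}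

module Defs where

open import Algebra.Apartness.Bundles using (HeytingField; HeytingCommutativeRing)
open import Algebra.Bundles using (Ring; CommutativeRing)
import Algebra.Construct.Pointwise as Pointwise
import Algebra.Definitions as AlgebraDefinitions
open import Algebra.Module.Bundles using (LeftModule)
import Algebra.Module.Construct.TensorUnit as TensorUnit
import Algebra.Module.Morphism.Construct.Composition as Composition
import Algebra.Module.Morphism.Construct.Identity as Identity
open import Algebra.Module.Morphism.Structures using (module LeftModuleMorphisms)
open import Algebra.Morphism.Structures using (module RingMorphisms)
import Algebra.Properties.Monoid.Sum as MonoidSum
import Algebra.Properties.Semiring.Sum as SemiringSum
open import Data.Bool.Base using (if_then_else_; true; false)
open import Data.Fin.Base using (Fin; zero; suc)
open import Data.Fin.Properties using (_≟_)
open import Data.Nat.Base using (ℕ; zero; suc; pred; _∸_; _^_; _≤_; NonZero)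
open import Data.Nat.Primality using (Prime)
open import Data.Product.Base using (Σ; ∃; ∃₂; ∃-syntax; Σ-syntax; _×_; _,_; proj₁; proj₂)
open import Data.Vec.Functional using (Vector; transpose)
open import Function.Base using (_∘_; id)
open import Function.Bundles using (Inverse)
open import Level using (Level; 0ℓ) renaming (suc to lsuc)
open import Relation.Binary.Bundles using (Setoid)
open import Relation.Binary.Definitions using (_Respects_)
import Relation.Binary.Construct.On as On
open import Relation.Binary.PropositionalEquality.Core using (_≡_)
import Relation.Binary.PropositionalEquality.Properties as ≡
import Relation.Binary.Reasoning.Setoid as SetoidReasoning
open import Relation.Nullary.Decidable.Core using (does)
open import Relation.Nullary.Negation using (¬_)
open import Relation.Unary using (Pred; _∈_; _⊆_; _≐_; _∩_; U)

PrimePower : Pred ℕ 0ℓ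
PrimePower q = ∃₂ λ p e → Prime p × NonZero e × q ≡ p ^ e

IsMinimum : ∀ {ℓ} → Pred ℕ ℓ → ℕ → Set ℓ
IsMinimum P a = a ∈ P × (∀ b → b ∈ P → a ≤ b)

IsMaximum : ∀ {ℓ} → Pred ℕ ℓ → ℕ → Set ℓ
IsMaximum P a = a ∈ P × (∀ b → b ∈ P → b ≤ a)

module MatrixAlgebra (R : Ring 0ℓ 0ℓ) where
  open Ring R hiding (zero)
  open SemiringSum semiring

  Matrix : ℕ → ℕ → Set
  Matrix a b = Vector (Vector Carrier b) a

  infix 4 _≋_ _≈ᵛ_
  infixl 7 _·ᵛ_ _·_

  _≈ᵛ_ : ∀ {a} → Vector Carrier a → Vector Carrier a → Set
  v ≈ᵛ w = ∀ i → v i ≈ w i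

  _≋_ : ∀ {a b} → Matrix a b → Matrix a b → Set
  A ≋ B = ∀ i → A i ≈ᵛ B i

  _·ᵛ_ : ∀ {a b} → Vector Carrier a → Matrix a b → Vector Carrier b
  (v ·ᵛ A) j = sum (λ i → v i * A i j)

  _·_ : ∀ {a b c} → Matrix a b → Matrix b c → Matrix a c
  (A · B) i = A i ·ᵛ B

  1ᴹ : ∀ {a} → Matrix a a
  1ᴹ i j = if does (i ≟ j) then 1# else 0#

  IsInvertible : ∀ {a} → Matrix a a → Set
  IsInvertible = AlgebraDefinitions.Invertible _≋_ 1ᴹ _·_

  ·ᵛ-cong : ∀ {a b} {v w : Vector Carrier a} {A B : Matrix a b} →
            v ≈ᵛ w → A ≋ B → v ·ᵛ A ≈ᵛ w ·ᵛ B
  ·ᵛ-cong v≈w A≋B j = sum-cong-≋ (λ i → *-cong (v≈w i) (A≋B i j))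

  ·ᵛ-assoc : ∀ {a b c} (v : Vector Carrier a) (A : Matrix a b) (B : Matrix b c) →
             (v ·ᵛ A) ·ᵛ B ≈ᵛ v ·ᵛ (A · B)
  ·ᵛ-assoc v A B l = begin
    sum (λ j → sum (λ i → v i * A i j) * B j l)
      ≈⟨ sum-cong-≋ (λ j → *-distribʳ-sum (B j l) (λ i → v i * A i j)) ⟩
    sum (λ j → sum (λ i → v i * A i j * B j l))
      ≈⟨ sum-cong-≋ (λ j → sum-cong-≋ (λ i → *-assoc (v i) (A i j) (B j l))) ⟩
    sum (λ j → sum (λ i → v i * (A i j * B j l)))
      ≈⟨ ∑-comm (λ j i → v i * (A i j * B j l)) ⟩
    sum (λ i → sum (λ j → v i * (A i j * B j l)))
      ≈⟨ sum-cong-≋ (λ i → *-distribˡ-sum (v i) (λ j → A i j * B j l)) ⟨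
    sum (λ i → v i * sum (λ j → A i j * B j l)) ∎
    where open SetoidReasoning setoid

  sum-zero : ∀ {a} (v : Vector Carrier a) → sum (λ i → v i * 0#) ≈ 0#
  sum-zero {a} v = trans (sum-cong-≋ (λ i → zeroʳ (v i))) (sum-replicate-zero a)

  ·ᵛ-identityʳ : ∀ {a} (v : Vector Carrier a) → v ·ᵛ 1ᴹ ≈ᵛ v
  ·ᵛ-identityʳ v zero =
    trans (+-cong (*-identityʳ (v zero)) (sum-zero (v ∘ suc))) (+-identityʳ (v zero))
  ·ᵛ-identityʳ v (suc j) =
    trans (+-cong (zeroʳ (v zero)) (·ᵛ-identityʳ (v ∘ suc) j)) (+-identityˡ (v (suc j)))

  inverse-· : ∀ {a} (A A′ B B′ : Matrix a a) → A · B ≋ 1ᴹ → A′ · B′ ≋ 1ᴹ →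
              (A · A′) · (B′ · B) ≋ 1ᴹ
  inverse-· A A′ B B′ AB≋1 A′B′≋1 i j = begin
    ((A i ·ᵛ A′) ·ᵛ (B′ · B)) j   ≈⟨ ·ᵛ-assoc (A i ·ᵛ A′) B′ B j ⟨
    (((A i ·ᵛ A′) ·ᵛ B′) ·ᵛ B) j  ≈⟨ ·ᵛ-cong {A = B} {B = B} (·ᵛ-assoc (A i) A′ B′) (λ _ _ → refl) j ⟩
    ((A i ·ᵛ (A′ · B′)) ·ᵛ B) j   ≈⟨ ·ᵛ-cong {A = B} {B = B} (·ᵛ-cong {v = A i} {w = A i} (λ _ → refl) A′B′≋1) (λ _ _ → refl) j ⟩
    ((A i ·ᵛ 1ᴹ) ·ᵛ B) j          ≈⟨ ·ᵛ-cong {A = B} {B = B} (·ᵛ-identityʳ (A i)) (λ _ _ → refl) j ⟩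
    (A i ·ᵛ B) j                  ≈⟨ AB≋1 i j ⟩
    1ᴹ i j                        ∎
    where open SetoidReasoning setoid

module LinearAlgebra {R : Ring 0ℓ 0ℓ} (M : LeftModule R 0ℓ 0ℓ) where
  open Ring R using (Carrier; _≈_; 0#)
  open LeftModule M
  open MonoidSum +ᴹ-monoid using (sum)

  lincomb : ∀ {n} → Vector Carrier n → Vector Carrierᴹ n → Carrierᴹ
  lincomb a v = sum (λ i → a i *ₗ v i)

  record IsSubspace (P : Pred Carrierᴹ 0ℓ) : Set where
    field
      resp      : P Respects _≈ᴹ_
      0-closed  : 0ᴹ ∈ P
      +-closed  : ∀ {x y} → x ∈ P → y ∈ P → x +ᴹ y ∈ P
      *-closed  : ∀ a {x} → x ∈ P → a *ₗ x ∈ P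

  ⟨_⟩ : ∀ {n} → Vector Carrierᴹ n → Pred Carrierᴹ 0ℓ
  ⟨ v ⟩ x = ∃[ a ] lincomb a v ≈ᴹ x

  Span : Pred Carrierᴹ 0ℓ → Pred Carrierᴹ 0ℓ
  Span P x = ∃[ l ] Σ[ v ∈ Vector Carrierᴹ l ] (∀ i → v i ∈ P) × x ∈ ⟨ v ⟩

  LinearlyIndependent : ∀ {n} → Vector Carrierᴹ n → Set
  LinearlyIndependent v = ∀ a → lincomb a v ≈ᴹ 0ᴹ → ∀ i → a i ≈ 0#

  IsBasis : ∀ {n} → Pred Carrierᴹ 0ℓ → Vector Carrierᴹ n → Set
  IsBasis P v = LinearlyIndependent v × ⟨ v ⟩ ≐ P

  -- "dim P = n", as a relation.
  HasDim : Pred Carrierᴹ 0ℓ → ℕ → Set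
  HasDim P n = Σ[ v ∈ Vector Carrierᴹ n ] IsBasis P v

  image : (Carrierᴹ → Carrierᴹ) → Pred Carrierᴹ 0ℓ → Pred Carrierᴹ 0ℓ
  image f P y = ∃[ x ] x ∈ P × f x ≈ᴹ y

  open LeftModuleMorphisms rawLeftModule rawLeftModule public
    using (IsLeftModuleIsomorphism; module IsLeftModuleIsomorphism)

  isIso-inverse : ∀ {f} → IsLeftModuleIsomorphism f →
                  Σ[ g ∈ (Carrierᴹ → Carrierᴹ) ]
                    IsLeftModuleIsomorphism g × (∀ x → g (f x) ≈ᴹ x)
  isIso-inverse {f} iso = g , gIso , gf
    where
    module f = IsLeftModuleIsomorphism iso

    g : Carrierᴹ → Carrierᴹ
    g y = proj₁ (f.surjective y)

    fg : ∀ y → f (g y) ≈ᴹ y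
    fg y = proj₂ (f.surjective y) ≈ᴹ-refl

    gf : ∀ x → g (f x) ≈ᴹ x
    gf x = f.injective (fg (f x))

    gIso : IsLeftModuleIsomorphism g
    gIso = record
      { isLeftModuleMonomorphism = record
        { isLeftModuleHomomorphism = record
          { +ᴹ-isGroupHomomorphism = record
            { isMonoidHomomorphism = record
              { isMagmaHomomorphism = record
                { isRelHomomorphism = record
                  { cong = λ {x} {y} x≈y → f.injective
                      (≈ᴹ-trans (fg x) (≈ᴹ-trans x≈y (≈ᴹ-sym (fg y)))) }
                ; homo = λ x y → f.injective (≈ᴹ-trans (fg (x +ᴹ y))
                    (≈ᴹ-sym (≈ᴹ-trans (f.+ᴹ-homo (g x) (g y)) (+ᴹ-cong (fg x) (fg y)))))
                }
              ; ε-homo = f.injective (≈ᴹ-trans (fg 0ᴹ) (≈ᴹ-sym f.0ᴹ-homo))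
              }
            ; ⁻¹-homo = λ x → f.injective (≈ᴹ-trans (fg (-ᴹ x))
                (≈ᴹ-sym (≈ᴹ-trans (f.-ᴹ-homo (g x)) (-ᴹ‿cong (fg x)))))
            }
          ; *ₗ-homo = λ a x → f.injective (≈ᴹ-trans (fg (a *ₗ x))
              (≈ᴹ-sym (≈ᴹ-trans (f.*ₗ-homo a (g x)) (*ₗ-cong (Ring.refl R) (fg x)))))
          }
        ; injective = λ {x} {y} gx≈gy →
            ≈ᴹ-trans (≈ᴹ-sym (fg x)) (≈ᴹ-trans (f.⟦⟧-cong gx≈gy) (fg y))
        }
      ; surjective = λ x → f x , λ {y} y≈fx → f.injective (≈ᴹ-trans (fg y) y≈fx)
      }

power : ∀ {R : Ring 0ℓ 0ℓ} → LeftModule R 0ℓ 0ℓ → ℕ → LeftModule R 0ℓ 0ℓ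
power M n = record
  { Carrierᴹ = Vector Carrierᴹ n
  ; _≈ᴹ_ = λ v w → ∀ i → v i ≈ᴹ w i
  ; _+ᴹ_ = λ v w i → v i +ᴹ w i
  ; _*ₗ_ = λ a v i → a *ₗ v i
  ; 0ᴹ   = λ _ → 0ᴹ
  ; -ᴹ_  = λ v i → -ᴹ v i
  ; isLeftModule = record
    { isLeftSemimodule = record
      { +ᴹ-isCommutativeMonoid = Pointwise.isCommutativeMonoid (Fin n) +ᴹ-isCommutativeMonoid
      ; isPreleftSemimodule = record
        { *ₗ-cong      = λ a≈b v≈w i → *ₗ-cong a≈b (v≈w i)
        ; *ₗ-zeroˡ     = λ v i → *ₗ-zeroˡ (v i)
        ; *ₗ-distribʳ  = λ v a b i → *ₗ-distribʳ (v i) a b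
        ; *ₗ-identityˡ = λ v i → *ₗ-identityˡ (v i)
        ; *ₗ-assoc     = λ a b v i → *ₗ-assoc a b (v i)
        ; *ₗ-zeroʳ     = λ a i → *ₗ-zeroʳ a
        ; *ₗ-distribˡ  = λ a v w i → *ₗ-distribˡ a (v i) (w i)
        }
      }
    ; -ᴹ‿cong    = λ v≈w i → -ᴹ‿cong (v≈w i)
    ; -ᴹ‿inverse = (λ v i → -ᴹ‿inverseˡ (v i)) , (λ v i → -ᴹ‿inverseʳ (v i))
    }
  }
  where open LeftModule M

module _ {R S : Ring 0ℓ 0ℓ} where
  private
    module R = Ring R
    module S = Ring S
  open RingMorphisms R.rawRing S.rawRing

  restrictScalars : ∀ {φ : R.Carrier → S.Carrier} → IsRingHomomorphism φ →
                    LeftModule S 0ℓ 0ℓ → LeftModule R 0ℓ 0ℓ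
  restrictScalars {φ} φ-homo M = record
    { Carrierᴹ = Carrierᴹ
    ; _≈ᴹ_ = _≈ᴹ_
    ; _+ᴹ_ = _+ᴹ_
    ; _*ₗ_ = λ a x → φ a *ₗ x
    ; 0ᴹ   = 0ᴹ
    ; -ᴹ_  = -ᴹ_
    ; isLeftModule = record
      { isLeftSemimodule = record
        { +ᴹ-isCommutativeMonoid = +ᴹ-isCommutativeMonoid
        ; isPreleftSemimodule = record
          { *ₗ-cong      = λ a≈b → *ₗ-cong (φ.⟦⟧-cong a≈b)
          ; *ₗ-zeroˡ     = λ x → ≈ᴹ-trans (*ₗ-cong φ.0#-homo ≈ᴹ-refl) (*ₗ-zeroˡ x)
          ; *ₗ-distribʳ  = λ x a b → ≈ᴹ-trans (*ₗ-cong (φ.+-homo a b) ≈ᴹ-refl) (*ₗ-distribʳ x (φ a) (φ b))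
          ; *ₗ-identityˡ = λ x → ≈ᴹ-trans (*ₗ-cong φ.1#-homo ≈ᴹ-refl) (*ₗ-identityˡ x)
          ; *ₗ-assoc     = λ a b x → ≈ᴹ-trans (*ₗ-cong (φ.*-homo a b) ≈ᴹ-refl) (*ₗ-assoc (φ a) (φ b) x)
          ; *ₗ-zeroʳ     = λ a → *ₗ-zeroʳ (φ a)
          ; *ₗ-distribˡ  = λ a → *ₗ-distribˡ (φ a)
          }
        }
      ; -ᴹ‿cong    = -ᴹ‿cong
      ; -ᴹ‿inverse = -ᴹ‿inverse
      }
    }
    where
    open LeftModule M
    module φ = IsRingHomomorphism φ-homo

-- A Heyting field is automatically nontrivial, and discrete when it is finite.
record FiniteField (N : ℕ) : Set₁ where
  field
    heytingField : HeytingField 0ℓ 0ℓ 0ℓ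

  commutativeRing : CommutativeRing 0ℓ 0ℓ
  commutativeRing =
    HeytingCommutativeRing.commutativeRing (HeytingField.heytingCommutativeRing heytingField)

  open CommutativeRing commutativeRing public

  field
    enumeration : Inverse setoid (≡.setoid (Fin N))

-- Any ring homomorphism from a field to a field is injective, so ι embeds F
-- as a subfield of K; comparing cardinalities, the degree of K over F is m.
record FieldExtension (q m : ℕ) : Set₁ where
  field
    F : FiniteField q
    K : FiniteField (q ^ m)

  module F = FiniteField F
  module K = FiniteField K

  field
    ι      : F.Carrier → K.Carrier
    ι-homo : RingMorphisms.IsRingHomomorphism F.rawRing K.rawRing ι

  F^ : ℕ → LeftModule F.ring 0ℓ 0ℓ
  F^ n = power (TensorUnit.leftModule {R = F.ring}) n

  K^ : ℕ → LeftModule K.ring 0ℓ 0ℓ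
  K^ n = power (TensorUnit.leftModule {R = K.ring}) n

  K-over-F : LeftModule F.ring 0ℓ 0ℓ
  K-over-F = restrictScalars ι-homo (TensorUnit.leftModule {R = K.ring})

  K^-over-F : ℕ → LeftModule F.ring 0ℓ 0ℓ
  K^-over-F n = restrictScalars ι-homo (K^ n)

record OrderedBasis {q m : ℕ} (E : FieldExtension q m) : Set where
  open FieldExtension E
  open LinearAlgebra K-over-F
  field
    γ       : Vector K.Carrier m
    isBasis : IsBasis U γ

  coordinates : K.Carrier → Vector F.Carrier m
  coordinates x = proj₁ (proj₂ (proj₂ isBasis) {x} _)

module RankMetric {q m : ℕ} (E : FieldExtension q m) (Γ : OrderedBasis E) where
  open FieldExtension E
  open OrderedBasis Γ using (coordinates)

  module Fᴹ = MatrixAlgebra F.ring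
  module Kᴹ = MatrixAlgebra K.ring
  module F^n {n} = LinearAlgebra (F^ n)
  module K^n {n} = LinearAlgebra (K^ n)
  module K^n/F {n} = LinearAlgebra (K^-over-F n)
  module ι = RingMorphisms.IsRingHomomorphism ι-homo

  private variable
    n k d : ℕ

  open Fᴹ using () renaming (Matrix to Matrixᶠ)
  open Kᴹ using (_≈ᵛ_; _·ᵛ_) renaming (Matrix to Matrixᵏ)

  -- The definitions below use Γ only through coordinates, and are independent
  -- of it up to extensional equality.
  Γ-matrix : Vector K.Carrier n → Matrixᶠ n m
  Γ-matrix v i = coordinates (v i)

  rankSupport : Vector K.Carrier n → Pred (Vector F.Carrier n) 0ℓ
  rankSupport v = F^n.⟨ transpose (Γ-matrix v) ⟩

  HasRank : Vector K.Carrier n → ℕ → Set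
  HasRank v = F^n.HasDim (rankSupport v)

  IsZero : Vector K.Carrier n → Set
  IsZero {n} v = LeftModule._≈ᴹ_ (K^ n) v (LeftModule.0ᴹ (K^ n))

  record Code (n k d : ℕ) : Set₁ where
    field
      carrier      : Pred (Vector K.Carrier n) 0ℓ
      isSubspace   : K^n.IsSubspace carrier
      dimension    : K^n.HasDim carrier k
      minimumRank  : IsMinimum (λ r → ∃[ v ] v ∈ carrier × ¬ IsZero v × HasRank v r) d

  -- The sum of the subspaces σ(v) is the span of their union.
  Nondegenerate : Pred (Code n k d) 0ℓ
  Nondegenerate C = F^n.Span (λ x → ∃[ v ] v ∈ carrier × x ∈ rankSupport v) ≐ U
    where open Code C

  Minimal : Pred (Code n k d) 0ℓ
  Minimal C = ∀ v v′ → v ∈ carrier → v′ ∈ carrier →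
              rankSupport v′ ⊆ rankSupport v → ∃[ α ] v′ ≈ᵛ (λ i → α K.* v i)
    where open Code C

  record IsHyperplane (H : Pred (Vector K.Carrier k) 0ℓ) : Set where
    field
      isSubspace : K^n.IsSubspace H
      dimension  : K^n.HasDim H (pred k)

  record System (n k d : ℕ) : Set₁ where
    field
      carrier    : Pred (Vector K.Carrier k) 0ℓ
      isSubspace : K^n/F.IsSubspace carrier
      dimension  : K^n/F.HasDim carrier n
      spanning   : K^n.Span carrier ≐ U
      distance   : ∃[ e ] d ≡ n ∸ e ×
                   IsMaximum (λ s → ∃[ H ] IsHyperplane H × K^n/F.HasDim (carrier ∩ H) s) e

  CuttingBlockingSet : Pred (System n k d) (lsuc 0ℓ)
  CuttingBlockingSet S = ∀ H H′ → IsHyperplane H → IsHyperplane H′ →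
                         (carrier ∩ H) ⊆ (carrier ∩ H′) → H ≐ H′
    where open System S

  _⊙_ : Vector K.Carrier n → Matrixᶠ n n → Vector K.Carrier n
  v ⊙ A = v ·ᵛ (λ i j → ι (A i j))

  CodeEquivalent : Pred (Vector K.Carrier n) 0ℓ → Pred (Vector K.Carrier n) 0ℓ → Set
  CodeEquivalent {n} C C′ = Σ[ A ∈ Matrixᶠ n n ] Fᴹ.IsInvertible A ×
                            C′ ≐ (λ w → ∃[ v ] v ∈ C × v ⊙ A ≈ᵛ w)

  SystemEquivalent : Pred (Vector K.Carrier k) 0ℓ → Pred (Vector K.Carrier k) 0ℓ → Set
  SystemEquivalent S S′ = ∃[ f ] K^n.IsLeftModuleIsomorphism f × K^n.image f S ≐ S′

  ⊙-cong : ∀ {v w : Vector K.Carrier n} (A : Matrixᶠ n n) → v ≈ᵛ w → v ⊙ A ≈ᵛ w ⊙ A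
  ⊙-cong A v≈w = Kᴹ.·ᵛ-cong {A = λ i j → ι (A i j)} v≈w (λ _ _ → K.refl)

  module ΣF = MonoidSum F.+-monoid
  module ΣK = MonoidSum K.+-monoid

  ι-sum : (a : Vector F.Carrier n) → ι (ΣF.sum a) K.≈ ΣK.sum (ι ∘ a)
  ι-sum {zero}  a = ι.0#-homo
  ι-sum {suc n} a = K.trans (ι.+-homo (a zero) (ΣF.sum (a ∘ suc)))
                            (K.+-cong K.refl (ι-sum (a ∘ suc)))

  ι-1ᴹ : (i j : Fin n) → ι (Fᴹ.1ᴹ i j) K.≈ Kᴹ.1ᴹ i j
  ι-1ᴹ i j with does (i ≟ j)
  ... | true  = ι.1#-homo
  ... | false = ι.0#-homo

  ⊙-identityʳ : (v : Vector K.Carrier n) (A : Matrixᶠ n n) → A Fᴹ.≋ Fᴹ.1ᴹ → v ⊙ A ≈ᵛ v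
  ⊙-identityʳ v A A≋1 j = K.trans
    (Kᴹ.·ᵛ-cong {v = v} (λ _ → K.refl) (λ i j → K.trans (ι.⟦⟧-cong (A≋1 i j)) (ι-1ᴹ i j)) j)
    (Kᴹ.·ᵛ-identityʳ v j)

  ⊙-assoc : (v : Vector K.Carrier n) (A B : Matrixᶠ n n) → (v ⊙ A) ⊙ B ≈ᵛ v ⊙ (A Fᴹ.· B)
  ⊙-assoc v A B j = K.trans (Kᴹ.·ᵛ-assoc v (λ i j → ι (A i j)) (λ i j → ι (B i j)) j)
    (Kᴹ.·ᵛ-cong {v = v} (λ _ → K.refl) (λ i l → K.sym (K.trans (ι-sum (λ j → A i j F.* B j l))
      (ΣK.sum-cong-≋ (λ j → ι.*-homo (A i j) (B j l))))) j)

  respC : (C : Code n k d) → Code.carrier C Respects _≈ᵛ_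
  respC C = K^n.IsSubspace.resp (Code.isSubspace C)

  respS : (S : System n k d) → System.carrier S Respects _≈ᵛ_
  respS S = K^n/F.IsSubspace.resp (System.isSubspace S)

  ≈ᵛ-trans : {u v w : Vector K.Carrier n} → u ≈ᵛ v → v ≈ᵛ w → u ≈ᵛ w
  ≈ᵛ-trans p q i = K.trans (p i) (q i)

  ≈ᵛ-sym : {u v : Vector K.Carrier n} → u ≈ᵛ v → v ≈ᵛ u
  ≈ᵛ-sym p i = K.sym (p i)

  ≈ᵛ-refl : {u : Vector K.Carrier n} → u ≈ᵛ u
  ≈ᵛ-refl i = K.refl

  _≈C_ : Code n k d → Code n k d → Set
  C ≈C C′ = CodeEquivalent (Code.carrier C) (Code.carrier C′)

  ≈C-refl : {C : Code n k d} → C ≈C C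
  ≈C-refl {C = C} = Fᴹ.1ᴹ , (Fᴹ.1ᴹ , 1·1 , 1·1) ,
    (λ {v} v∈C → v , v∈C , 1ᵛ v) ,
    (λ { (v , v∈C , v1≈w) → respC C (≈ᵛ-trans (≈ᵛ-sym (1ᵛ v)) v1≈w) v∈C })
    where
    1·1 : ∀ {n} → (Fᴹ._·_ {n} Fᴹ.1ᴹ Fᴹ.1ᴹ) Fᴹ.≋ Fᴹ.1ᴹ
    1·1 i = Fᴹ.·ᵛ-identityʳ (Fᴹ.1ᴹ i)
    1ᵛ : ∀ {n} (v : Vector K.Carrier n) → v ⊙ Fᴹ.1ᴹ ≈ᵛ v
    1ᵛ v = ⊙-identityʳ v Fᴹ.1ᴹ (λ _ _ → F.refl)

  ≈C-sym : {C C′ : Code n k d} → C ≈C C′ → C′ ≈C C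
  ≈C-sym {C = C} (A , (B , BA , AB) , C′⊆ , ⊆C′) = B , (A , AB , BA) ,
    (λ {v} v∈C → v ⊙ A , ⊆C′ (v , v∈C , ≈ᵛ-refl) , cancel v) ,
    (λ { (w , w∈C′ , wB≈x) → let (v , v∈C , vA≈w) = C′⊆ w∈C′ in
         respC C (≈ᵛ-trans (≈ᵛ-sym (cancel v)) (≈ᵛ-trans (⊙-cong B vA≈w) wB≈x)) v∈C })
    where
    cancel : ∀ v → (v ⊙ A) ⊙ B ≈ᵛ v
    cancel v = ≈ᵛ-trans (⊙-assoc v A B) (⊙-identityʳ v (A Fᴹ.· B) AB)

  ≈C-trans : {C C′ C″ : Code n k d} → C ≈C C′ → C′ ≈C C″ → C ≈C C″
  ≈C-trans (A , (B , BA , AB) , C′⊆ , ⊆C′) (A′ , (B′ , B′A′ , A′B′) , C″⊆ , ⊆C″) =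
    A Fᴹ.· A′ ,
    (B′ Fᴹ.· B , Fᴹ.inverse-· B′ B A′ A B′A′ BA , Fᴹ.inverse-· A A′ B B′ AB A′B′) ,
    (λ x∈C″ → let (w , w∈C′ , wA′≈x) = C″⊆ x∈C″
                  (v , v∈C , vA≈w)   = C′⊆ w∈C′ in
       v , v∈C , ≈ᵛ-trans (≈ᵛ-sym (⊙-assoc v A A′)) (≈ᵛ-trans (⊙-cong A′ vA≈w) wA′≈x)) ,
    (λ { (v , v∈C , vAA′≈x) →
       ⊆C″ (v ⊙ A , ⊆C′ (v , v∈C , ≈ᵛ-refl) , ≈ᵛ-trans (⊙-assoc v A A′) vAA′≈x) })

  _≈S_ : System n k d → System n k d → Set
  S ≈S S′ = SystemEquivalent (System.carrier S) (System.carrier S′)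

  ≈S-refl : {S : System n k d} → S ≈S S
  ≈S-refl {k = k} {S = S} =
    id , Identity.isLeftModuleIsomorphism (LeftModule.rawLeftModule (K^ k)) (λ _ → K.refl) ,
    (λ { (x , x∈S , x≈y) → respS S x≈y x∈S }) ,
    (λ {y} y∈S → y , y∈S , ≈ᵛ-refl)

  ≈S-sym : {S S′ : System n k d} → S ≈S S′ → S′ ≈S S
  ≈S-sym {S = S} (f , iso , fS⊆ , ⊆fS) with K^n.isIso-inverse iso
  ... | g , gIso , gf = g , gIso ,
    (λ { (y , y∈S′ , gy≈x) → let (x , x∈S , fx≈y) = ⊆fS y∈S′ in
         respS S (≈ᵛ-trans (≈ᵛ-sym (gf x)) (≈ᵛ-trans (g.⟦⟧-cong fx≈y) gy≈x)) x∈S }) ,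
    (λ {x} x∈S → f x , fS⊆ (x , x∈S , ≈ᵛ-refl) , gf x)
    where module g = K^n.IsLeftModuleIsomorphism gIso

  ≈S-trans : {S S′ S″ : System n k d} → S ≈S S′ → S′ ≈S S″ → S ≈S S″
  ≈S-trans (f , fIso , fS⊆ , ⊆fS) (g , gIso , gS⊆ , ⊆gS) =
    g ∘ f , Composition.isLeftModuleIsomorphism ≈ᵛ-trans fIso gIso ,
    (λ { (x , x∈S , gfx≈z) → gS⊆ (f x , fS⊆ (x , x∈S , ≈ᵛ-refl) , gfx≈z) }) ,
    (λ z∈S″ → let (y , y∈S′ , gy≈z) = ⊆gS z∈S″
                  (x , x∈S , fx≈y)  = ⊆fS y∈S′ in
       x , x∈S , ≈ᵛ-trans (g.⟦⟧-cong fx≈y) gy≈z)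
    where module g = K^n.IsLeftModuleIsomorphism gIso

  -- Classes are not types here: a map of classes is a map of representatives
  -- that respects the setoid equality, which is code or system equivalence.

  codes : (n k d : ℕ) → Setoid (lsuc 0ℓ) 0ℓ
  codes n k d = record
    { Carrier = Code n k d
    ; _≈_ = _≈C_
    ; isEquivalence = record
      { refl  = λ {C} → ≈C-refl {C = C}
      ; sym   = λ {C} {C′} → ≈C-sym {C = C} {C′}
      ; trans = λ {C} {C′} {C″} → ≈C-trans {C = C} {C′} {C″}
      }
    }

  systems : (n k d : ℕ) → Setoid (lsuc 0ℓ) 0ℓ
  systems n k d = record
    { Carrier = System n k d
    ; _≈_ = _≈S_
    ; isEquivalence = record
      { refl  = λ {S} → ≈S-refl {S = S}
      ; sym   = λ {S} {S′} → ≈S-sym {S = S} {S′}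
      ; trans = λ {S} {S′} {S″} → ≈S-trans {S = S} {S′} {S″}
      }
    }

  NondegenerateCode : (n k d : ℕ) → Set₁
  NondegenerateCode n k d = Σ (Code n k d) Nondegenerate

  nondegenerateCodes : (n k d : ℕ) → Setoid (lsuc 0ℓ) 0ℓ
  nondegenerateCodes n k d = On.setoid {B = NondegenerateCode n k d} (codes n k d) proj₁

  minimalCodes : (n k d : ℕ) → Setoid (lsuc 0ℓ) 0ℓ
  minimalCodes n k d = On.setoid {B = Σ (NondegenerateCode n k d) (Minimal ∘ proj₁)}
                         (nondegenerateCodes n k d) proj₁

  cuttingSystems : (n k d : ℕ) → Setoid (lsuc 0ℓ) 0ℓ
  cuttingSystems n k d = On.setoid {B = Σ (System n k d) CuttingBlockingSet} (systems n k d) proj₁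

  -- The maps Φ and Ψ.  They are only well defined on classes, so they are
  -- characterised, up to equivalence, by their value for every choice of G.
  -- The rows of G are its entries as a vector; its columns are those of
  -- transpose G.

  IsΦ : (NondegenerateCode n k d → System n k d) → Set₁
  IsΦ {n} {k} Φ = ∀ C (G : Matrixᵏ k n) → K^n.IsBasis (Code.carrier (proj₁ C)) G →
    SystemEquivalent K^n/F.⟨ transpose G ⟩ (System.carrier (Φ C))

  IsΨ : (System n k d → NondegenerateCode n k d) → Set₁
  IsΨ {n} {k} Ψ = ∀ S (G : Matrixᵏ k n) → K^n/F.IsBasis (System.carrier S) (transpose G) →
    CodeEquivalent K^n.⟨ G ⟩ (Code.carrier (proj₁ (Ψ S)))

{-# OPTIONS --safe #-}
module Submission where

-- Let the rows of G be a basis of the code C and its columns an F-basis of the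
-- system S, and write ⟨a, v⟩ = Σ ι(aⱼ) vⱼ for a ∈ Fⁿ and v ∈ Kⁿ.  Expanding v
-- in the basis Γ, ⟨a, v⟩ vanishes exactly when a annihilates the rank support
-- of v; and ⟨a, uG⟩ is the scalar product of u with the combination of the
-- columns of G given by a.  Hence S ∩ u^⊥ is isomorphic to the annihilator of
-- the support of uG: this gives rk(uG) + dim(S ∩ u^⊥) = n, and by double
-- annihilation S ∩ u^⊥ ⊆ S ∩ u′^⊥ if and only if the support of u′G lies in
-- that of uG.  As the hyperplanes are the u^⊥, with u determined up to a scalar,
-- C is minimal if and only if S is cutting.  Both equivalences of codes and of
-- systems amount to G′ = Q G B with Q ∈ GLₖ(K) and B ∈ GLₙ(F).

open import Defs
open import Algebra.Apartness.Bundles using (HeytingField)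
open import Algebra.Bundles using (Ring; CommutativeRing)
open import Algebra.Module.Bundles using (LeftModule)
import Algebra.Module.Construct.TensorUnit as TensorUnit
import Algebra.Properties.AbelianGroup as AbelianGroupProperties
import Algebra.Properties.CommutativeMonoid.Sum as CommutativeMonoidSum
import Algebra.Properties.Group as GroupProperties
import Algebra.Properties.Ring as RingProperties
import Algebra.Properties.Semiring.Sum as SemiringSum
open import Data.Fin.Base as Fin using (Fin; zero; suc; _↑ˡ_; _↑ʳ_; splitAt; punchIn)
import Data.Fin.Properties as Fin
open import Data.Nat.Base as ℕ using (ℕ; zero; suc; pred; _∸_; _≤_; z≤n; s≤s; NonZero) renaming (_+_ to _+ℕ_)
import Data.Nat.Properties as ℕ
open import Data.Product.Base using (∃₂; ∃-syntax; Σ-syntax; _×_; _,_; proj₁; proj₂)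
open import Data.Sum.Base using (inj₁; inj₂)
open import Data.Vec.Functional using (Vector; transpose; removeAt; _∷_; _++_)
open import Data.Vec.Functional.Properties using (lookup-++ˡ; lookup-++ʳ)
open import Function.Base using (_∘_)
open import Function.Bundles using (Inverse)
open import Level using (0ℓ) renaming (suc to lsuc)
open import Relation.Binary.Bundles using (Setoid)
open import Relation.Binary.PropositionalEquality.Core as ≡ using (_≡_)
import Relation.Binary.Reasoning.Setoid as SetoidReasoning
open import Relation.Nullary.Decidable.Core using (Dec; yes; no; map′)
open import Relation.Nullary.Negation using (¬_; contradiction)
open import Relation.Unary using (Pred; _∈_; _⊆_; _≐_; _∩_; U)

-- Subspaces are arbitrary predicates and dimensions are relations witnessed by bases, so every
-- count has to come from explicit matrices. The common tool is a factorization `A ≋ C · R` whose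
-- factors have one-sided inverses: weak inverses, kernel bases, double annihilation and
-- rank-nullity are read off it, over `F` and over `K` alike. That one matrix can serve both sides
-- is exactly what the side conditions provide. A code is nondegenerate if and only if the columns
-- of a generator matrix are independent over `F`, and the columns span over `K` if and only if the
-- rows are independent over `K`; both are annihilator arguments. No minimum or maximum is ever
-- searched for. Each side supplies a codeword or a hyperplane attaining its extremum, and the
-- constant sum of rank and section turns it into an extremum of the other side.

-- Vector and matrix arithmetic over a ring

module MatrixProperties (R : Ring 0ℓ 0ℓ) where
  open Ring R hiding (zero)
  open MatrixAlgebra R
  open SemiringSum semiring
  open RingProperties R using (-‿distribˡ-*; -‿distribʳ-*; [y-z]x≈yx-zx; x[y-z]≈xy-xz)

  infixl 6 _⊖ᵛ_ _⊖_

  0ᵛ : ∀ {a} → Vector Carrier a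
  0ᵛ _ = 0#

  _⊖ᵛ_ : ∀ {a} → Vector Carrier a → Vector Carrier a → Vector Carrier a
  (x ⊖ᵛ y) i = x i - y i

  _⊖_ : ∀ {a b} → Matrix a b → Matrix a b → Matrix a b
  (A ⊖ B) i = A i ⊖ᵛ B i

  vectorSetoid : ℕ → Setoid 0ℓ 0ℓ
  vectorSetoid a = record
    { Carrier = Vector Carrier a
    ; _≈_ = _≈ᵛ_
    ; isEquivalence = record
      { refl = λ i → refl
      ; sym = λ p i → sym (p i)
      ; trans = λ p q i → trans (p i) (q i)
      }
    }

  sum-≈0 : ∀ {a} {f : Vector Carrier a} → (∀ i → f i ≈ 0#) → sum f ≈ 0#
  sum-≈0 {a} f≈0 = trans (sum-cong-≋ f≈0) (sum-replicate-zero a)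

  sum-neg : ∀ {a} (f : Vector Carrier a) → sum (λ i → - f i) ≈ - sum f
  sum-neg {zero} f = sym (GroupProperties.ε⁻¹≈ε +-group)
  sum-neg {suc a} f = trans (+-congˡ (sum-neg (f ∘ suc)))
    (AbelianGroupProperties.⁻¹-∙-comm +-abelianGroup (f zero) (sum (f ∘ suc)))

  sum-minus : ∀ {a} (f g : Vector Carrier a) → sum (λ i → f i - g i) ≈ sum f - sum g
  sum-minus f g = trans (∑-distrib-+ f (λ i → - g i)) (+-congˡ (sum-neg g))

  sum-↑ : ∀ a {b} (f : Vector Carrier (a +ℕ b)) →
          sum f ≈ sum (λ i → f (i ↑ˡ b)) + sum (λ i → f (a ↑ʳ i))
  sum-↑ zero f = sym (+-identityˡ (sum f))
  sum-↑ (suc a) f = trans (+-congˡ (sum-↑ a (f ∘ suc))) (sym (+-assoc _ _ _))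

  ·ᵛ-congˡ : ∀ {a b} {x y : Vector Carrier a} (A : Matrix a b) → x ≈ᵛ y → x ·ᵛ A ≈ᵛ y ·ᵛ A
  ·ᵛ-congˡ A x≈y = ·ᵛ-cong {A = A} x≈y (λ _ _ → refl)

  ·ᵛ-congʳ : ∀ {a b} (x : Vector Carrier a) {A B : Matrix a b} → A ≋ B → x ·ᵛ A ≈ᵛ x ·ᵛ B
  ·ᵛ-congʳ x A≋B = ·ᵛ-cong {v = x} (λ _ → refl) A≋B

  ·ᵛ-zeroˡ : ∀ {a b} (A : Matrix a b) → 0ᵛ ·ᵛ A ≈ᵛ 0ᵛ
  ·ᵛ-zeroˡ A j = sum-≈0 (λ i → zeroˡ (A i j))

  ·ᵛ-≈0ˡ : ∀ {a b} {x : Vector Carrier a} (A : Matrix a b) → x ≈ᵛ 0ᵛ → x ·ᵛ A ≈ᵛ 0ᵛ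
  ·ᵛ-≈0ˡ A x≈0 j = trans (·ᵛ-congˡ A x≈0 j) (·ᵛ-zeroˡ A j)

  ·ᵛ-≈0ʳ : ∀ {a b} (x : Vector Carrier a) {A : Matrix a b} → (∀ i → A i ≈ᵛ 0ᵛ) → x ·ᵛ A ≈ᵛ 0ᵛ
  ·ᵛ-≈0ʳ x A≈0 j = trans (·ᵛ-congʳ x A≈0 j) (sum-zero x)

  ⊖ᵛ-·ᵛ : ∀ {a b} (x y : Vector Carrier a) (A : Matrix a b) →
          (x ⊖ᵛ y) ·ᵛ A ≈ᵛ x ·ᵛ A ⊖ᵛ y ·ᵛ A
  ⊖ᵛ-·ᵛ x y A j = trans (sum-cong-≋ (λ i → [y-z]x≈yx-zx (A i j) (x i) (y i)))
    (sum-minus (λ i → x i * A i j) (λ i → y i * A i j))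

  ·ᵛ-⊖ : ∀ {a b} (x : Vector Carrier a) (A B : Matrix a b) →
         x ·ᵛ (A ⊖ B) ≈ᵛ x ·ᵛ A ⊖ᵛ x ·ᵛ B
  ·ᵛ-⊖ x A B j = trans (sum-cong-≋ (λ i → x[y-z]≈xy-xz (x i) (A i j) (B i j)))
    (sum-minus (λ i → x i * A i j) (λ i → x i * B i j))

  +-·ᵛ : ∀ {a b} (x y : Vector Carrier a) (A : Matrix a b) →
         (λ i → x i + y i) ·ᵛ A ≈ᵛ (λ j → (x ·ᵛ A) j + (y ·ᵛ A) j)
  +-·ᵛ x y A j = trans (sum-cong-≋ (λ i → distribʳ (A i j) (x i) (y i)))
    (∑-distrib-+ (λ i → x i * A i j) (λ i → y i * A i j))

  neg-·ᵛ : ∀ {a b} (x : Vector Carrier a) (A : Matrix a b) →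
           (λ i → - x i) ·ᵛ A ≈ᵛ (λ j → - (x ·ᵛ A) j)
  neg-·ᵛ x A j = trans (sum-cong-≋ (λ i → sym (-‿distribˡ-* (x i) (A i j))))
    (sum-neg (λ i → x i * A i j))

  *-·ᵛ : ∀ {a b} c (x : Vector Carrier a) (A : Matrix a b) →
         (λ i → c * x i) ·ᵛ A ≈ᵛ (λ j → c * (x ·ᵛ A) j)
  *-·ᵛ c x A j = trans (sum-cong-≋ (λ i → *-assoc c (x i) (A i j)))
    (sym (*-distribˡ-sum c (λ i → x i * A i j)))

  ·ᵛ-identityˡ : ∀ {a b} (i : Fin a) (A : Matrix a b) → 1ᴹ i ·ᵛ A ≈ᵛ A i
  ·ᵛ-identityˡ zero A j =
    trans (+-cong (*-identityˡ (A zero j)) (·ᵛ-zeroˡ (A ∘ suc) j)) (+-identityʳ (A zero j))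
  ·ᵛ-identityˡ (suc i) A j =
    trans (+-cong (zeroˡ (A zero j)) (·ᵛ-identityˡ i (A ∘ suc) j)) (+-identityˡ (A (suc i) j))

  ⊖ᵛ-≈0 : ∀ {a} {x y : Vector Carrier a} → x ≈ᵛ y → x ⊖ᵛ y ≈ᵛ 0ᵛ
  ⊖ᵛ-≈0 x≈y i = GroupProperties.x≈y⇒x∙y⁻¹≈ε +-group (x≈y i)

  ≈0-⊖ᵛ : ∀ {a} {x y : Vector Carrier a} → x ⊖ᵛ y ≈ᵛ 0ᵛ → x ≈ᵛ y
  ≈0-⊖ᵛ x-y≈0 i = GroupProperties.x∙y⁻¹≈ε⇒x≈y +-group _ _ (x-y≈0 i)

  -- When L · C ≋ 1ᴹ this is the idempotent whose left kernel is the row space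
  -- of L and whose row space is the left kernel of C.
  residual : ∀ {a r} → Matrix a r → Matrix r a → Matrix a a
  residual C L = 1ᴹ ⊖ C · L

  ·ᵛ-residual : ∀ {a r} (x : Vector Carrier a) (C : Matrix a r) (L : Matrix r a) →
                x ·ᵛ residual C L ≈ᵛ x ⊖ᵛ (x ·ᵛ C) ·ᵛ L
  ·ᵛ-residual x C L i = trans (·ᵛ-⊖ x 1ᴹ (C · L) i)
    (+-cong (·ᵛ-identityʳ x i) (-‿cong (sym (·ᵛ-assoc x C L i))))

  module _ {a r} (C : Matrix a r) (L : Matrix r a) (LC≋1 : L · C ≋ 1ᴹ) where

    residual-· : ∀ x → (x ·ᵛ residual C L) ·ᵛ C ≈ᵛ 0ᵛ
    residual-· x = begin
      (x ·ᵛ residual C L) ·ᵛ C          ≈⟨ ·ᵛ-congˡ C (·ᵛ-residual x C L) ⟩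
      (x ⊖ᵛ (x ·ᵛ C) ·ᵛ L) ·ᵛ C         ≈⟨ ⊖ᵛ-·ᵛ x ((x ·ᵛ C) ·ᵛ L) C ⟩
      x ·ᵛ C ⊖ᵛ ((x ·ᵛ C) ·ᵛ L) ·ᵛ C    ≈⟨ ⊖ᵛ-≈0 step ⟩
      0ᵛ                                ∎
      where
      open SetoidReasoning (vectorSetoid r)
      step : x ·ᵛ C ≈ᵛ ((x ·ᵛ C) ·ᵛ L) ·ᵛ C
      step = begin
        x ·ᵛ C                    ≈⟨ ·ᵛ-identityʳ (x ·ᵛ C) ⟨
        (x ·ᵛ C) ·ᵛ 1ᴹ            ≈⟨ ·ᵛ-congʳ (x ·ᵛ C) LC≋1 ⟨
        (x ·ᵛ C) ·ᵛ (L · C)       ≈⟨ ·ᵛ-assoc (x ·ᵛ C) L C ⟨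
        ((x ·ᵛ C) ·ᵛ L) ·ᵛ C      ∎

    ·-residual : ∀ i → L i ·ᵛ residual C L ≈ᵛ 0ᵛ
    ·-residual i = begin
      L i ·ᵛ residual C L          ≈⟨ ·ᵛ-residual (L i) C L ⟩
      L i ⊖ᵛ (L i ·ᵛ C) ·ᵛ L       ≈⟨ ⊖ᵛ-≈0 step ⟩
      0ᵛ                           ∎
      where
      open SetoidReasoning (vectorSetoid a)
      step : L i ≈ᵛ (L i ·ᵛ C) ·ᵛ L
      step = begin
        L i                  ≈⟨ ·ᵛ-identityˡ i L ⟨
        1ᴹ i ·ᵛ L            ≈⟨ ·ᵛ-congˡ L (LC≋1 i) ⟨
        (L i ·ᵛ C) ·ᵛ L      ∎

    residual-fixes : ∀ x → x ·ᵛ C ≈ᵛ 0ᵛ → x ·ᵛ residual C L ≈ᵛ x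
    residual-fixes x xC≈0 = begin
      x ·ᵛ residual C L            ≈⟨ ·ᵛ-residual x C L ⟩
      x ⊖ᵛ (x ·ᵛ C) ·ᵛ L           ≈⟨ (λ i → +-congˡ (-‿cong (·ᵛ-≈0ˡ L xC≈0 i))) ⟩
      x ⊖ᵛ 0ᵛ                      ≈⟨ (λ i → trans (+-congˡ (GroupProperties.ε⁻¹≈ε +-group)) (+-identityʳ (x i))) ⟩
      x                            ∎
      where open SetoidReasoning (vectorSetoid a)

-- Linear combinations, spans and bases in a module

module ModuleProperties {R : Ring 0ℓ 0ℓ} (M : LeftModule R 0ℓ 0ℓ) where
  open Ring R using (Carrier; _≈_; _+_; _*_; -_; 0#; 1#)
  private module R = Ring R
  open LeftModule M
  open LinearAlgebra M
  open MatrixAlgebra R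
  open SemiringSum R.semiring using () renaming (sum to sumᴿ)
  open CommutativeMonoidSum +ᴹ-commutativeMonoid
    using (sum; sum-cong-≋; sum-replicate-zero; ∑-comm; ∑-distrib-+)
  open MatrixProperties R using (0ᵛ; ≈0-⊖ᵛ)
  open SetoidReasoning ≈ᴹ-setoid

  *ₗ-distribˡ-sum : ∀ {n} c (v : Vector Carrierᴹ n) → c *ₗ sum v ≈ᴹ sum (λ i → c *ₗ v i)
  *ₗ-distribˡ-sum {zero} c v = *ₗ-zeroʳ c
  *ₗ-distribˡ-sum {suc n} c v = ≈ᴹ-trans (*ₗ-distribˡ c (v zero) (sum (v ∘ suc)))
    (+ᴹ-congˡ (*ₗ-distribˡ-sum c (v ∘ suc)))

  *ₗ-distribʳ-sum : ∀ {n} (a : Vector Carrier n) x → sumᴿ a *ₗ x ≈ᴹ sum (λ i → a i *ₗ x)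
  *ₗ-distribʳ-sum {zero} a x = *ₗ-zeroˡ x
  *ₗ-distribʳ-sum {suc n} a x = ≈ᴹ-trans (*ₗ-distribʳ x (a zero) (sumᴿ (a ∘ suc)))
    (+ᴹ-congˡ (*ₗ-distribʳ-sum (a ∘ suc) x))

  lincomb-cong : ∀ {n} {a b : Vector Carrier n} {v w : Vector Carrierᴹ n} →
                 a ≈ᵛ b → (∀ i → v i ≈ᴹ w i) → lincomb a v ≈ᴹ lincomb b w
  lincomb-cong a≈b v≈w = sum-cong-≋ (λ i → *ₗ-cong (a≈b i) (v≈w i))

  lincomb-congˡ : ∀ {n} {a b : Vector Carrier n} (v : Vector Carrierᴹ n) →
                  a ≈ᵛ b → lincomb a v ≈ᴹ lincomb b v
  lincomb-congˡ v a≈b = lincomb-cong a≈b (λ _ → ≈ᴹ-refl)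

  lincomb-congʳ : ∀ {n} (a : Vector Carrier n) {v w : Vector Carrierᴹ n} →
                  (∀ i → v i ≈ᴹ w i) → lincomb a v ≈ᴹ lincomb a w
  lincomb-congʳ a v≈w = lincomb-cong {a = a} (λ _ → R.refl) v≈w

  lincomb-·ᵛ : ∀ {n l} (x : Vector Carrier n) (A : Matrix n l) (v : Vector Carrierᴹ l) →
               lincomb (x ·ᵛ A) v ≈ᴹ lincomb x (λ i → lincomb (A i) v)
  lincomb-·ᵛ x A v = begin
    sum (λ j → sumᴿ (λ i → x i * A i j) *ₗ v j)
      ≈⟨ sum-cong-≋ (λ j → *ₗ-distribʳ-sum (λ i → x i * A i j) (v j)) ⟩
    sum (λ j → sum (λ i → (x i * A i j) *ₗ v j))
      ≈⟨ sum-cong-≋ (λ j → sum-cong-≋ (λ i → *ₗ-assoc (x i) (A i j) (v j))) ⟩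
    sum (λ j → sum (λ i → x i *ₗ (A i j *ₗ v j)))
      ≈⟨ ∑-comm (λ j i → x i *ₗ (A i j *ₗ v j)) ⟩
    sum (λ i → sum (λ j → x i *ₗ (A i j *ₗ v j)))
      ≈⟨ sum-cong-≋ (λ i → *ₗ-distribˡ-sum (x i) (λ j → A i j *ₗ v j)) ⟨
    sum (λ i → x i *ₗ lincomb (A i) v) ∎

  lincomb-0ᵛ : ∀ {n} (v : Vector Carrierᴹ n) → lincomb 0ᵛ v ≈ᴹ 0ᴹ
  lincomb-0ᵛ {n} v = ≈ᴹ-trans (sum-cong-≋ (λ i → *ₗ-zeroˡ (v i))) (sum-replicate-zero n)

  lincomb-1ᴹ : ∀ {n} (i : Fin n) (v : Vector Carrierᴹ n) → lincomb (1ᴹ i) v ≈ᴹ v i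
  lincomb-1ᴹ zero v = ≈ᴹ-trans (+ᴹ-cong (*ₗ-identityˡ (v zero)) (lincomb-0ᵛ (v ∘ suc)))
    (+ᴹ-identityʳ (v zero))
  lincomb-1ᴹ (suc i) v = ≈ᴹ-trans (+ᴹ-cong (*ₗ-zeroˡ (v zero)) (lincomb-1ᴹ i (v ∘ suc)))
    (+ᴹ-identityˡ (v (suc i)))

  lincomb-+ : ∀ {n} (a b : Vector Carrier n) (v : Vector Carrierᴹ n) →
              lincomb (λ i → a i + b i) v ≈ᴹ lincomb a v +ᴹ lincomb b v
  lincomb-+ a b v = ≈ᴹ-trans (sum-cong-≋ (λ i → *ₗ-distribʳ (v i) (a i) (b i)))
    (∑-distrib-+ (λ i → a i *ₗ v i) (λ i → b i *ₗ v i))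

  lincomb-* : ∀ {n} c (a : Vector Carrier n) (v : Vector Carrierᴹ n) →
              lincomb (λ i → c * a i) v ≈ᴹ c *ₗ lincomb a v
  lincomb-* c a v = ≈ᴹ-trans (sum-cong-≋ (λ i → *ₗ-assoc c (a i) (v i)))
    (≈ᴹ-sym (*ₗ-distribˡ-sum c (λ i → a i *ₗ v i)))

  ∈⟨⟩ : ∀ {n} (v : Vector Carrierᴹ n) i → v i ∈ ⟨ v ⟩
  ∈⟨⟩ v i = 1ᴹ i , lincomb-1ᴹ i v

  ⟨⟩-isSubspace : ∀ {n} (v : Vector Carrierᴹ n) → IsSubspace ⟨ v ⟩
  ⟨⟩-isSubspace v = record
    { resp = λ x≈y (a , eq) → a , ≈ᴹ-trans eq x≈y
    ; 0-closed = 0ᵛ , lincomb-0ᵛ v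
    ; +-closed = λ (a , p) (b , q) → (λ i → a i + b i) , ≈ᴹ-trans (lincomb-+ a b v) (+ᴹ-cong p q)
    ; *-closed = λ c (a , p) → (λ i → c * a i) , ≈ᴹ-trans (lincomb-* c a v) (*ₗ-cong R.refl p)
    }

  module _ {P : Pred Carrierᴹ 0ℓ} (P-isSubspace : IsSubspace P) where
    open IsSubspace P-isSubspace

    lincomb-closed : ∀ {n} (a : Vector Carrier n) (v : Vector Carrierᴹ n) →
                     (∀ i → v i ∈ P) → lincomb a v ∈ P
    lincomb-closed {zero} a v v∈P = 0-closed
    lincomb-closed {suc n} a v v∈P =
      +-closed (*-closed (a zero) (v∈P zero)) (lincomb-closed (a ∘ suc) (v ∘ suc) (v∈P ∘ suc))

    ⟨⟩-least : ∀ {n} {v : Vector Carrierᴹ n} → (∀ i → v i ∈ P) → ⟨ v ⟩ ⊆ P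
    ⟨⟩-least {v = v} v∈P (a , eq) = resp eq (lincomb-closed a v v∈P)

    Span-least : ∀ {Q : Pred Carrierᴹ 0ℓ} → Q ⊆ P → Span Q ⊆ P
    Span-least Q⊆P (l , v , v∈Q , x∈⟨v⟩) = ⟨⟩-least (λ i → Q⊆P (v∈Q i)) x∈⟨v⟩

  lincomb-injective : ∀ {n} {v : Vector Carrierᴹ n} → LinearlyIndependent v →
                      ∀ a b → lincomb a v ≈ᴹ lincomb b v → a ≈ᵛ b
  lincomb-injective {v = v} indep a b av≈bv = ≈0-⊖ᵛ (indep (λ i → a i + - b i) (begin
    lincomb (λ i → a i + - b i) v
      ≈⟨ lincomb-+ a (λ i → - b i) v ⟩
    lincomb a v +ᴹ lincomb (λ i → - b i) v
      ≈⟨ +ᴹ-cong av≈bv ≈ᴹ-refl ⟩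
    lincomb b v +ᴹ lincomb (λ i → - b i) v
      ≈⟨ lincomb-+ b (λ i → - b i) v ⟨
    lincomb (λ i → b i + - b i) v
      ≈⟨ lincomb-congˡ v (λ i → R.-‿inverseʳ (b i)) ⟩
    lincomb 0ᵛ v
      ≈⟨ lincomb-0ᵛ v ⟩
    0ᴹ ∎))

  module IsBasisProperties {n} {P : Pred Carrierᴹ 0ℓ} {v : Vector Carrierᴹ n} (basis : IsBasis P v) where

    independent : LinearlyIndependent v
    independent = proj₁ basis

    ∈-basis : ∀ i → v i ∈ P
    ∈-basis i = proj₁ (proj₂ basis) (∈⟨⟩ v i)

    lincomb∈ : ∀ a → lincomb a v ∈ P
    lincomb∈ a = proj₁ (proj₂ basis) (a , ≈ᴹ-refl)

    coords : ∀ {x} → x ∈ P → Vector Carrier n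
    coords x∈P = proj₁ (proj₂ (proj₂ basis) x∈P)

    lincomb-coords : ∀ {x} (x∈P : x ∈ P) → lincomb (coords x∈P) v ≈ᴹ x
    lincomb-coords x∈P = proj₂ (proj₂ (proj₂ basis) x∈P)

  IsBasis-resp-≐ : ∀ {n} {P Q : Pred Carrierᴹ 0ℓ} {v : Vector Carrierᴹ n} →
                   P ≐ Q → IsBasis P v → IsBasis Q v
  IsBasis-resp-≐ (P⊆Q , Q⊆P) (indep , ⊆P , P⊆) = indep , (λ x → P⊆Q (⊆P x)) , (λ x → P⊆ (Q⊆P x))

  HasDim-resp-≐ : ∀ {n} {P Q : Pred Carrierᴹ 0ℓ} → P ≐ Q → HasDim P n → HasDim Q n
  HasDim-resp-≐ P≐Q (v , basis) = v , IsBasis-resp-≐ P≐Q basis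

  -- A one-sided inverse already bounds `n` by `l` over a field, and exchanging the two bases gives
  -- the opposite bound; this is the source of invariance of dimension.
  basis-change : ∀ {n l} {P : Pred Carrierᴹ 0ℓ} {v : Vector Carrierᴹ n} {w : Vector Carrierᴹ l} →
                 IsBasis P v → IsBasis P w →
                 ∃₂ λ (X : Matrix n l) (Y : Matrix l n) → X · Y ≋ 1ᴹ
  basis-change {n} {l} {v = v} {w} v-basis w-basis = X , Y ,
    λ i → lincomb-injective V.independent ((X · Y) i) (1ᴹ i) (begin
      lincomb ((X · Y) i) v               ≈⟨ lincomb-·ᵛ (X i) Y v ⟩
      lincomb (X i) (λ j → lincomb (Y j) v) ≈⟨ lincomb-congʳ (X i) (λ j → V.lincomb-coords (W.∈-basis j)) ⟩
      lincomb (X i) w                     ≈⟨ W.lincomb-coords (V.∈-basis i) ⟩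
      v i                                 ≈⟨ lincomb-1ᴹ i v ⟨
      lincomb (1ᴹ i) v                    ∎)
    where
    module V = IsBasisProperties v-basis
    module W = IsBasisProperties w-basis
    X : Matrix n l
    X i = W.coords (V.∈-basis i)
    Y : Matrix l n
    Y j = V.coords (W.∈-basis j)

  isIso-lincomb : ∀ {f} → IsLeftModuleIsomorphism f →
                  ∀ {n} (a : Vector Carrier n) v → f (lincomb a v) ≈ᴹ lincomb a (f ∘ v)
  isIso-lincomb iso {zero} a v = IsLeftModuleIsomorphism.0ᴹ-homo iso
  isIso-lincomb {f} iso {suc n} a v = begin
    f (a zero *ₗ v zero +ᴹ lincomb (a ∘ suc) (v ∘ suc))
      ≈⟨ iso.+ᴹ-homo (a zero *ₗ v zero) (lincomb (a ∘ suc) (v ∘ suc)) ⟩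
    f (a zero *ₗ v zero) +ᴹ f (lincomb (a ∘ suc) (v ∘ suc))
      ≈⟨ +ᴹ-cong (iso.*ₗ-homo (a zero) (v zero)) (isIso-lincomb iso (a ∘ suc) (v ∘ suc)) ⟩
    a zero *ₗ f (v zero) +ᴹ lincomb (a ∘ suc) (f ∘ v ∘ suc) ∎
    where module iso = IsLeftModuleIsomorphism iso

module _ {R : Ring 0ℓ 0ℓ} (M : LeftModule R 0ℓ 0ℓ) where
  open LeftModule M
  open LinearAlgebra using (lincomb)

  -- The bridge between the abstract `lincomb` of a power module and the entrywise sums of `·ᵛ`. For
  -- a variable `n` the sum does not reduce, so the two agree only by induction.
  lincomb-power : ∀ {k n} (a : Vector (Ring.Carrier R) n) (v : Vector (Vector Carrierᴹ k) n) j →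
                  lincomb (power M k) a v j ≈ᴹ lincomb M a (λ i → v i j)
  lincomb-power {n = zero} a v j = ≈ᴹ-refl
  lincomb-power {n = suc n} a v j = +ᴹ-congˡ (lincomb-power (a ∘ suc) (v ∘ suc) j)

-- Linear algebra over a discrete field

-- Elimination has to find a nonzero entry and divide by it, hence decidable equality and an inverse
-- obtained from `¬ x ≈ 0#` rather than from an apartness.
record IsDiscreteField (CR : CommutativeRing 0ℓ 0ℓ) : Set where
  open CommutativeRing CR
  infix 4 _≈?_
  field
    _≈?_    : ∀ x y → Dec (x ≈ y)
    1≉0     : ¬ 1# ≈ 0#
    inverse : ∀ x → ¬ x ≈ 0# → ∃[ y ] y * x ≈ 1#

module FieldLinearAlgebra (CR : CommutativeRing 0ℓ 0ℓ) (isDiscreteField : IsDiscreteField CR) where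
  open CommutativeRing CR hiding (zero)
  open IsDiscreteField isDiscreteField
  open MatrixAlgebra ring
  open MatrixProperties ring
  open SemiringSum semiring using (sum; sum-cong-≋; sum-remove; *-distribʳ-sum)
  private module Reasoning {a} = SetoidReasoning (vectorSetoid a)

  infix 7 _∙_

  -- Scalar products are products with a one-column matrix, so that the laws of `·ᵛ` and the results
  -- on `LeftKernel` carry over to `_∙_` and `Perp`.
  column : ∀ {a} → Vector Carrier a → Matrix a 1
  column u i _ = u i

  _∙_ : ∀ {a} → Vector Carrier a → Vector Carrier a → Carrier
  x ∙ u = (x ·ᵛ column u) zero

  Perp : ∀ {a} → Vector Carrier a → Pred (Vector Carrier a) 0ℓ
  Perp u x = x ∙ u ≈ 0#

  LeftKernel : ∀ {a b} → Matrix a b → Pred (Vector Carrier a) 0ℓ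
  LeftKernel A x = x ·ᵛ A ≈ᵛ 0ᵛ

  ∙-comm : ∀ {a} (x y : Vector Carrier a) → x ∙ y ≈ y ∙ x
  ∙-comm x y = sum-cong-≋ (λ i → *-comm (x i) (y i))

  ∙-zeroʳ : ∀ {a} (x : Vector Carrier a) {u : Vector Carrier a} → u ≈ᵛ 0ᵛ → x ∙ u ≈ 0#
  ∙-zeroʳ x {u} u≈0 = ·ᵛ-≈0ʳ x {column u} (λ i _ → u≈0 i) zero

  ∙-congʳ : ∀ {a} (x : Vector Carrier a) {u v : Vector Carrier a} → u ≈ᵛ v → x ∙ u ≈ x ∙ v
  ∙-congʳ x {u} {v} u≈v = ·ᵛ-congʳ x {column u} {column v} (λ i _ → u≈v i) zero

  ∙-congˡ : ∀ {a} {x y : Vector Carrier a} (u : Vector Carrier a) → x ≈ᵛ y → x ∙ u ≈ y ∙ u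
  ∙-congˡ u x≈y = ·ᵛ-congˡ (column u) x≈y zero

  1ᴹ-∙ : ∀ {a} (i : Fin a) (u : Vector Carrier a) → 1ᴹ i ∙ u ≈ u i
  1ᴹ-∙ i u = ·ᵛ-identityˡ i (column u) zero

  ∙-adjoint : ∀ {a b} (x : Vector Carrier a) (A : Matrix a b) (u : Vector Carrier b) →
              (x ·ᵛ A) ∙ u ≈ x ∙ (u ·ᵛ transpose A)
  ∙-adjoint x A u = trans (·ᵛ-assoc x A (column u) zero) (∙-congʳ x (λ i → ∙-comm (A i) u))

  1ᴹ-sym : ∀ {a} (i j : Fin a) → 1ᴹ i j ≡ 1ᴹ j i
  1ᴹ-sym zero zero = ≡.refl
  1ᴹ-sym zero (suc j) = ≡.refl
  1ᴹ-sym (suc i) zero = ≡.refl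
  1ᴹ-sym (suc i) (suc j) = 1ᴹ-sym i j

  transpose-· : ∀ {a b c} (A : Matrix a b) (B : Matrix b c) →
                transpose (A · B) ≋ transpose B · transpose A
  transpose-· A B i j = sum-cong-≋ (λ l → *-comm (A j l) (B l i))

  transpose-·-≋1 : ∀ {a b} (A : Matrix a b) (B : Matrix b a) → A · B ≋ 1ᴹ →
                   transpose B · transpose A ≋ 1ᴹ
  transpose-·-≋1 A B AB≋1 i j =
    trans (sym (transpose-· A B i j)) (trans (AB≋1 j i) (reflexive (1ᴹ-sym j i)))

  ≈ᵛ? : ∀ {a} (x y : Vector Carrier a) → Dec (x ≈ᵛ y)
  ≈ᵛ? x y = Fin.all? (λ i → x i ≈? y i)

  ≉0⇒entry : ∀ {a} (x : Vector Carrier a) → ¬ x ≈ᵛ 0ᵛ → ∃[ i ] ¬ x i ≈ 0#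
  ≉0⇒entry {a} x x≉0 = Fin.¬∀⟶∃¬ a (λ i → x i ≈ 0#) (λ i → x i ≈? 0#) x≉0

  ·-1ʳ : ∀ {a b} (x : Vector Carrier a) (A : Matrix a b) (B : Matrix b a) → A · B ≋ 1ᴹ →
         (x ·ᵛ A) ·ᵛ B ≈ᵛ x
  ·-1ʳ x A B AB≋1 = begin
    (x ·ᵛ A) ·ᵛ B   ≈⟨ ·ᵛ-assoc x A B ⟩
    x ·ᵛ (A · B)    ≈⟨ ·ᵛ-congʳ x AB≋1 ⟩
    x ·ᵛ 1ᴹ         ≈⟨ ·ᵛ-identityʳ x ⟩
    x               ∎
    where open Reasoning

  -- Full-rank factorizations, weak inverses and annihilators

  -- The inverses `L` and `S` certify full column rank of `C` and full row rank of `R` in a form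
  -- that calculations can use directly.
  record FullRankFactorization {a b} (A : Matrix a b) : Set where
    field
      {rank} : ℕ
      C      : Matrix a rank
      R      : Matrix rank b
      L      : Matrix rank a
      S      : Matrix b rank
      A≋CR   : A ≋ C · R
      LC≋1   : L · C ≋ 1ᴹ
      RS≋1   : R · S ≋ 1ᴹ

  -- Adding the row v to A = C · R: either v lies in the row space of R, or the
  -- residual w of v modulo R is a new row of R, dual to a multiple of a column
  -- of 1ᴹ - S · R.
  factorize : ∀ {a b} (A : Matrix a b) → FullRankFactorization A
  factorize {zero} A = record
    { rank = 0 ; C = λ () ; R = λ () ; L = λ () ; S = λ _ () ; A≋CR = λ () ; LC≋1 = λ () ; RS≋1 = λ () }
  factorize {suc a} {b} A = extend (≈ᵛ? w 0ᵛ)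
    where
    open FullRankFactorization (factorize (A ∘ suc))
    v w : Vector Carrier b
    v = A zero
    y : Vector Carrier rank
    y = v ·ᵛ S
    E : Matrix b b
    E = residual S R
    w = v ·ᵛ E

    extend : Dec (w ≈ᵛ 0ᵛ) → FullRankFactorization A
    extend (yes w≈0) = record
      { C = y ∷ C ; R = R ; L = λ i → 0# ∷ L i ; S = S
      ; A≋CR = λ { zero → ≈0-⊖ᵛ (λ j → trans (sym (·ᵛ-residual v S R j)) (w≈0 j))
                 ; (suc i) → A≋CR i }
      ; LC≋1 = λ i j → trans (+-cong (zeroˡ (y j)) (LC≋1 i j)) (+-identityˡ _)
      ; RS≋1 = RS≋1
      }
    extend (no w≉0) with ≉0⇒entry w w≉0
    ... | j₀ , wj₀≉0 with inverse (w j₀) wj₀≉0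
    ... | c , cw≈1 = record
      { C = (1# ∷ y) ∷ (λ i → 0# ∷ C i)
      ; R = w ∷ R
      -- `C` has become block triangular with `y` beside the new `1#`; the entry `- (y ·ᵛ L)`
      -- cancels this `y`, because `L · C ≋ 1ᴹ`.
      ; L = (1# ∷ (λ i → - (y ·ᵛ L) i)) ∷ (λ i → 0# ∷ L i)
      ; S = λ i → s i ∷ S i
      ; A≋CR = λ { zero j → sym (row-v j)
                 ; (suc i) j → trans (A≋CR i j) (sym (trans (+-congʳ (zeroˡ (w j))) (+-identityˡ _))) }
      ; LC≋1 = λ { zero zero → trans (+-cong (*-identityˡ 1#) (sum-zero (λ i → - (y ·ᵛ L) i))) (+-identityʳ 1#)
                 ; zero (suc j) → trans (+-cong (*-identityˡ (y j)) (trans (neg-·ᵛ (y ·ᵛ L) C j)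
                     (-‿cong (·-1ʳ y L C LC≋1 j)))) (-‿inverseʳ (y j))
                 ; (suc i) zero → trans (+-cong (zeroˡ 1#) (sum-zero (L i))) (+-identityʳ 0#)
                 ; (suc i) (suc j) → trans (+-cong (zeroˡ (y j)) (LC≋1 i j)) (+-identityˡ _) }
      ; RS≋1 = λ { zero zero → trans (∙-s w) (trans (*-congʳ (residual-fixes S R RS≋1 w wS≈0 j₀))
                     (trans (*-comm (w j₀) c) cw≈1))
                 ; zero (suc j) → wS≈0 j
                 ; (suc i) zero → trans (∙-s (R i)) (trans (*-congʳ (·-residual S R RS≋1 i j₀)) (zeroˡ c))
                 ; (suc i) (suc j) → RS≋1 i j }
      }
      where
      s : Vector Carrier b
      s i = E i j₀ * c
      wS≈0 : w ·ᵛ S ≈ᵛ 0ᵛ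
      wS≈0 = residual-· S R RS≋1 v
      ∙-s : ∀ x → x ∙ s ≈ (x ·ᵛ E) j₀ * c
      ∙-s x = trans (sum-cong-≋ (λ i → sym (*-assoc (x i) (E i j₀) c)))
        (sym (*-distribʳ-sum c (λ i → x i * E i j₀)))
      row-v : ∀ j → 1# * w j + (y ·ᵛ R) j ≈ v j
      row-v j = begin
        1# * w j + (y ·ᵛ R) j                 ≈⟨ +-congʳ (*-identityˡ (w j)) ⟩
        w j + (y ·ᵛ R) j                      ≈⟨ +-congʳ (·ᵛ-residual v S R j) ⟩
        (v j - (y ·ᵛ R) j) + (y ·ᵛ R) j       ≈⟨ +-assoc _ _ _ ⟩
        v j + (- (y ·ᵛ R) j + (y ·ᵛ R) j)     ≈⟨ +-congˡ (-‿inverseˡ _) ⟩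
        v j + 0#                              ≈⟨ +-identityʳ (v j) ⟩
        v j                                   ∎
        where open SetoidReasoning setoid

  -- Transposition exchanges `C` with `R` and `L` with `S` and keeps `rank`: row rank and column
  -- rank agree.
  transposeFactorization : ∀ {a b} {A : Matrix a b} →
                           FullRankFactorization A → FullRankFactorization (transpose A)
  transposeFactorization φ = record
    { C = transpose R ; R = transpose C ; L = transpose S ; S = transpose L
    ; A≋CR = λ i j → trans (A≋CR j i) (transpose-· C R i j)
    ; LC≋1 = transpose-·-≋1 R S RS≋1
    ; RS≋1 = transpose-·-≋1 L C LC≋1
    }
    where open FullRankFactorization φ

  module FactorizationProperties {a b} {A : Matrix a b} (φ : FullRankFactorization A) where
    open FullRankFactorization φ

    ·ᵛ-factor : ∀ x → x ·ᵛ A ≈ᵛ (x ·ᵛ C) ·ᵛ R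
    ·ᵛ-factor x = begin
      x ·ᵛ A             ≈⟨ ·ᵛ-congʳ x A≋CR ⟩
      x ·ᵛ (C · R)       ≈⟨ ·ᵛ-assoc x C R ⟨
      (x ·ᵛ C) ·ᵛ R      ∎
      where open Reasoning

    ·ᵛ-A-S : ∀ x → (x ·ᵛ A) ·ᵛ S ≈ᵛ x ·ᵛ C
    ·ᵛ-A-S x = begin
      (x ·ᵛ A) ·ᵛ S            ≈⟨ ·ᵛ-congˡ S (·ᵛ-factor x) ⟩
      ((x ·ᵛ C) ·ᵛ R) ·ᵛ S     ≈⟨ ·-1ʳ (x ·ᵛ C) R S RS≋1 ⟩
      x ·ᵛ C                   ∎
      where open Reasoning

    ·ᵛ-L-A : ∀ y → (y ·ᵛ L) ·ᵛ A ≈ᵛ y ·ᵛ R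
    ·ᵛ-L-A y = begin
      (y ·ᵛ L) ·ᵛ A            ≈⟨ ·ᵛ-factor (y ·ᵛ L) ⟩
      ((y ·ᵛ L) ·ᵛ C) ·ᵛ R     ≈⟨ ·ᵛ-congˡ R (·-1ʳ y L C LC≋1) ⟩
      y ·ᵛ R                   ∎
      where open Reasoning

  -- `A · S` is `C` and `L · A` is `R`, so `A · (S · L) · A` collapses to `C · R`. This is an
  -- inverse in the sense of von Neumann, available for every matrix.
  generalizedInverse : ∀ {a b} (A : Matrix a b) →
                       Σ[ A⁻ ∈ Matrix b a ] (∀ x → ((x ·ᵛ A) ·ᵛ A⁻) ·ᵛ A ≈ᵛ x ·ᵛ A)
  generalizedInverse A = S · L , λ x → begin
    ((x ·ᵛ A) ·ᵛ (S · L)) ·ᵛ A      ≈⟨ ·ᵛ-congˡ A (·ᵛ-assoc (x ·ᵛ A) S L) ⟨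
    (((x ·ᵛ A) ·ᵛ S) ·ᵛ L) ·ᵛ A     ≈⟨ ·ᵛ-L-A ((x ·ᵛ A) ·ᵛ S) ⟩
    ((x ·ᵛ A) ·ᵛ S) ·ᵛ R            ≈⟨ ·ᵛ-congˡ R (·ᵛ-A-S x) ⟩
    (x ·ᵛ C) ·ᵛ R                   ≈⟨ ·ᵛ-factor x ⟨
    x ·ᵛ A                          ∎
    where
    φ = factorize A
    open FullRankFactorization φ
    open FactorizationProperties φ
    open Reasoning

  module _ {a b} (A : Matrix a b) where
    private
      A⁻ = proj₁ (generalizedInverse A)

    -- The rows of `1ᴹ - A · A⁻` are explicit kernel vectors. The two results that follow apply
    -- their hypothesis on the kernel to these rows only.
    defect∈LeftKernel : ∀ i → 1ᴹ i ⊖ᵛ A i ·ᵛ A⁻ ∈ LeftKernel A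
    defect∈LeftKernel i = begin
      (1ᴹ i ⊖ᵛ A i ·ᵛ A⁻) ·ᵛ A           ≈⟨ ⊖ᵛ-·ᵛ (1ᴹ i) (A i ·ᵛ A⁻) A ⟩
      1ᴹ i ·ᵛ A ⊖ᵛ (A i ·ᵛ A⁻) ·ᵛ A      ≈⟨ ⊖ᵛ-≈0 step ⟩
      0ᵛ                                 ∎
      where
      open Reasoning
      step : 1ᴹ i ·ᵛ A ≈ᵛ (A i ·ᵛ A⁻) ·ᵛ A
      step = begin
        1ᴹ i ·ᵛ A                        ≈⟨ proj₂ (generalizedInverse A) (1ᴹ i) ⟨
        ((1ᴹ i ·ᵛ A) ·ᵛ A⁻) ·ᵛ A         ≈⟨ ·ᵛ-congˡ A (·ᵛ-congˡ A⁻ (·ᵛ-identityˡ i A)) ⟩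
        (A i ·ᵛ A⁻) ·ᵛ A                 ∎

    rightInverse : (∀ x → x ∈ LeftKernel A → x ≈ᵛ 0ᵛ) → ∃[ B ] A · B ≋ 1ᴹ
    rightInverse A-injective = A⁻ , λ i j → sym (≈0-⊖ᵛ (A-injective _ (defect∈LeftKernel i)) j)

    -- Tested on the rows of `1ᴹ - A · A⁻`, the hypothesis says that `A · A⁻` fixes the column `b`,
    -- so `A⁻` applied to `b` is a solution. Over `F` this compares rank supports; over `K` it
    -- serves for hyperplanes, spanning and proportionality of normals.
    double-annihilator : ∀ b → LeftKernel A ⊆ Perp b → ∃[ z ] z ·ᵛ transpose A ≈ᵛ b
    double-annihilator b ker⊆ = z , λ i → begin
      (z ·ᵛ transpose A) i      ≈⟨ ∙-comm z (A i) ⟩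
      A i ∙ z                   ≈⟨ ·ᵛ-assoc (A i) A⁻ (column b) zero ⟨
      (A i ·ᵛ A⁻) ∙ b           ≈⟨ ≈0-⊖ᵛ {x = λ _ → 1ᴹ i ∙ b} {λ _ → (A i ·ᵛ A⁻) ∙ b} (λ _ → step i) (zero {0}) ⟨
      1ᴹ i ∙ b                  ≈⟨ 1ᴹ-∙ i b ⟩
      b i                       ∎
      where
      open SetoidReasoning setoid
      z = λ j → A⁻ j ∙ b
      step : ∀ i → 1ᴹ i ∙ b - (A i ·ᵛ A⁻) ∙ b ≈ 0#
      step i = trans (sym (⊖ᵛ-·ᵛ (1ᴹ i) (A i ·ᵛ A⁻) (column b) zero)) (ker⊆ (defect∈LeftKernel i))

  -- Clear an entry X₀ⱼ ≉ 0 of the first row from the others, then delete row 0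
  -- and column j of X, and row j and column 0 of Y.
  rightInvertible⇒≤ : ∀ {a b} (X : Matrix a b) (Y : Matrix b a) → X · Y ≋ 1ᴹ → a ≤ b
  rightInvertible⇒≤ {zero} X Y XY≋1 = z≤n
  rightInvertible⇒≤ {suc a} {zero} X Y XY≋1 = contradiction (sym (XY≋1 zero zero)) 1≉0
  rightInvertible⇒≤ {suc a} {suc b} X Y XY≋1 =
    s≤s (rightInvertible⇒≤ X′ (λ i l → Y (punchIn j i) (suc l)) X′Y′≋1)
    where
    X₀≉0 : ¬ X zero ≈ᵛ 0ᵛ
    X₀≉0 X₀≈0 = 1≉0 (trans (sym (XY≋1 zero zero)) (·ᵛ-≈0ˡ Y X₀≈0 zero))
    j = proj₁ (≉0⇒entry (X zero) X₀≉0)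
    d = proj₁ (inverse (X zero j) (proj₂ (≉0⇒entry (X zero) X₀≉0)))
    dX≈1 = proj₂ (inverse (X zero j) (proj₂ (≉0⇒entry (X zero) X₀≉0)))
    c : Fin a → Carrier
    c i = X (suc i) j * d
    Z : Matrix a (suc b)
    Z i = X (suc i) ⊖ᵛ (λ l → c i * X zero l)
    X′ : Matrix a b
    X′ i = removeAt (Z i) j
    Zj≈0 : ∀ i → Z i j ≈ 0#
    Zj≈0 i = trans (+-congˡ (-‿cong (trans (*-assoc _ d _) (trans (*-congˡ dX≈1) (*-identityʳ _)))))
      (-‿inverseʳ _)
    open SetoidReasoning setoid
    X′Y′≋1 : X′ · (λ i l → Y (punchIn j i) (suc l)) ≋ 1ᴹ
    X′Y′≋1 i l = begin
      (X′ · (λ i l → Y (punchIn j i) (suc l))) i l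
        ≈⟨ +-identityˡ _ ⟨
      0# + (X′ · (λ i l → Y (punchIn j i) (suc l))) i l
        ≈⟨ +-congʳ (trans (*-congʳ (Zj≈0 i)) (zeroˡ _)) ⟨
      Z i j * Y j (suc l) + (X′ · (λ i l → Y (punchIn j i) (suc l))) i l
        ≈⟨ sum-remove {i = j} (λ t → Z i t * Y t (suc l)) ⟨
      (Z i ·ᵛ Y) (suc l)
        ≈⟨ ⊖ᵛ-·ᵛ (X (suc i)) (λ l → c i * X zero l) Y (suc l) ⟩
      (X (suc i) ·ᵛ Y) (suc l) - ((λ l → c i * X zero l) ·ᵛ Y) (suc l)
        ≈⟨ +-cong (XY≋1 (suc i) (suc l)) (-‿cong (*-·ᵛ (c i) (X zero) Y (suc l))) ⟩
      1ᴹ i l - c i * (X zero ·ᵛ Y) (suc l)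
        ≈⟨ +-congˡ (-‿cong (trans (*-congˡ (XY≋1 zero (suc l))) (zeroʳ (c i)))) ⟩
      1ᴹ i l - 0#
        ≈⟨ +-congˡ (GroupProperties.ε⁻¹≈ε +-group) ⟩
      1ᴹ i l + 0#
        ≈⟨ +-identityʳ _ ⟩
      1ᴹ i l ∎

  -- Invariance of dimension

  independent⇒≤ : ∀ {a b} (A : Matrix a b) → (∀ x → x ∈ LeftKernel A → x ≈ᵛ 0ᵛ) → a ≤ b
  independent⇒≤ A A-injective = rightInvertible⇒≤ A _ (proj₂ (rightInverse A A-injective))

  -- An arbitrary module is allowed because dimensions are compared in coordinate spaces and also in
  -- the powers of `K` regarded over `F`.
  HasDim-unique : (M : LeftModule ring 0ℓ 0ℓ) {P : Pred (LeftModule.Carrierᴹ M) 0ℓ} {a b : ℕ} →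
                  LinearAlgebra.HasDim M P a → LinearAlgebra.HasDim M P b → a ≡ b
  HasDim-unique M (v , v-basis) (w , w-basis) = ℕ.≤-antisym (le v-basis w-basis) (le w-basis v-basis)
    where
    open LinearAlgebra M
    le : ∀ {a b} {P : Pred _ 0ℓ} {v : Vector _ a} {w : Vector _ b} →
         IsBasis P v → IsBasis P w → a ≤ b
    le v-basis w-basis with ModuleProperties.basis-change M v-basis w-basis
    ... | X , Y , XY≋1 = rightInvertible⇒≤ X Y XY≋1

  -- Coordinate spaces and rank-nullity

  coordinateSpace : ℕ → LeftModule ring 0ℓ 0ℓ
  coordinateSpace a = power (TensorUnit.leftModule {R = ring}) a

  private module V {a} = LinearAlgebra (coordinateSpace a)
  open V using (IsBasis; HasDim; IsSubspace; ⟨_⟩; LinearlyIndependent; lincomb)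

  lincomb≈·ᵛ : ∀ {a b} (x : Vector Carrier a) (A : Matrix a b) → lincomb x A ≈ᵛ x ·ᵛ A
  lincomb≈·ᵛ = lincomb-power (TensorUnit.leftModule {R = ring})

  independent⇒injective : ∀ {a b} {A : Matrix a b} → LinearlyIndependent A →
                          ∀ x → x ∈ LeftKernel A → x ≈ᵛ 0ᵛ
  independent⇒injective {A = A} indep x xA≈0 = indep x (λ j → trans (lincomb≈·ᵛ x A j) (xA≈0 j))

  injective⇒independent : ∀ {a b} {A : Matrix a b} → (∀ x → x ∈ LeftKernel A → x ≈ᵛ 0ᵛ) →
                          LinearlyIndependent A
  injective⇒independent {A = A} inj x xA≈0 = inj x (λ j → trans (sym (lincomb≈·ᵛ x A j)) (xA≈0 j))

  ·ᵛ⇒∈⟨⟩ : ∀ {a b} {A : Matrix a b} x {y : Vector Carrier b} → x ·ᵛ A ≈ᵛ y → y ∈ ⟨ A ⟩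
  ·ᵛ⇒∈⟨⟩ {A = A} x xA≈y = x , λ j → trans (lincomb≈·ᵛ x A j) (xA≈y j)

  ∈⟨⟩⇒·ᵛ : ∀ {a b} {A : Matrix a b} {y : Vector Carrier b} → y ∈ ⟨ A ⟩ → ∃[ x ] x ·ᵛ A ≈ᵛ y
  ∈⟨⟩⇒·ᵛ {A = A} (x , eq) = x , λ j → trans (sym (lincomb≈·ᵛ x A j)) (eq j)

  LeftKernel-isSubspace : ∀ {a b} (A : Matrix a b) → IsSubspace (LeftKernel A)
  LeftKernel-isSubspace A = record
    { resp = λ x≈y xA≈0 j → trans (sym (·ᵛ-congˡ A x≈y j)) (xA≈0 j)
    ; 0-closed = ·ᵛ-zeroˡ A
    ; +-closed = λ {x} {y} xA≈0 yA≈0 j → trans (+-·ᵛ x y A j)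
        (trans (+-cong (xA≈0 j) (yA≈0 j)) (+-identityʳ 0#))
    ; *-closed = λ c {x} xA≈0 j → trans (*-·ᵛ c x A j) (trans (*-congˡ (xA≈0 j)) (zeroʳ c))
    }

  Perp-isSubspace : ∀ {a} (u : Vector Carrier a) → IsSubspace (Perp u)
  Perp-isSubspace u = record
    { resp = λ x≈y xu≈0 → trans (∙-congˡ u (λ i → sym (x≈y i))) xu≈0
    ; 0-closed = K.0-closed zero
    ; +-closed = λ {x} {y} p q → K.+-closed {x} {y} (λ _ → p) (λ _ → q) zero
    ; *-closed = λ c {x} p → K.*-closed c {x} (λ _ → p) zero
    }
    where
    module K = IsSubspace (LeftKernel-isSubspace (column u))

  ·ᵛ-isIso : ∀ {a} {X Y : Matrix a a} → X · Y ≋ 1ᴹ → Y · X ≋ 1ᴹ →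
             V.IsLeftModuleIsomorphism (_·ᵛ X)
  ·ᵛ-isIso {X = X} {Y} XY≋1 YX≋1 = record
    { isLeftModuleMonomorphism = record
      { isLeftModuleHomomorphism = record
        { +ᴹ-isGroupHomomorphism = record
          { isMonoidHomomorphism = record
            { isMagmaHomomorphism = record
              { isRelHomomorphism = record { cong = ·ᵛ-congˡ X }
              ; homo = λ x y → +-·ᵛ x y X
              }
            ; ε-homo = ·ᵛ-zeroˡ X
            }
          ; ⁻¹-homo = λ x → neg-·ᵛ x X
          }
        ; *ₗ-homo = λ c x → *-·ᵛ c x X
        }
      ; injective = λ {x} {y} xX≈yX i →
          trans (sym (·-1ʳ x X Y XY≋1 i)) (trans (·ᵛ-congˡ Y xX≈yX i) (·-1ʳ y X Y XY≋1 i))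
      }
    ; surjective = λ y → y ·ᵛ Y , λ z≈yY i → trans (·ᵛ-congˡ X z≈yY i) (·-1ʳ y Y X YX≋1 i)
    }

  rowSpace-basis : ∀ {a b} {A : Matrix a b} (φ : FullRankFactorization A) →
                   IsBasis ⟨ A ⟩ (FullRankFactorization.R φ)
  rowSpace-basis φ = injective⇒independent R-injective
    , (λ y∈⟨R⟩ → let (y , eq) = ∈⟨⟩⇒·ᵛ y∈⟨R⟩ in ·ᵛ⇒∈⟨⟩ (y ·ᵛ L) (λ j → trans (·ᵛ-L-A y j) (eq j)))
    , (λ y∈⟨A⟩ → let (x , eq) = ∈⟨⟩⇒·ᵛ y∈⟨A⟩ in ·ᵛ⇒∈⟨⟩ (x ·ᵛ C) (λ j → trans (sym (·ᵛ-factor x j)) (eq j)))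
    where
    open FullRankFactorization φ
    open FactorizationProperties φ
    R-injective : ∀ x → x ∈ LeftKernel R → x ≈ᵛ 0ᵛ
    R-injective x xR≈0 j = trans (sym (·-1ʳ x R S RS≋1 j)) (·ᵛ-≈0ˡ S xR≈0 j)

  -- The rows of `residual C L` generate the left kernel, and a second factorization extracts a
  -- basis `N` from them. The dimensions add up because the rows of `L` and of `N` together form a
  -- basis of the whole space. The column space is used since rank supports are column spaces.
  rank-nullity : ∀ {a b} (A : Matrix a b) →
                 ∃₂ λ r s → r +ℕ s ≡ a × HasDim ⟨ transpose A ⟩ r × HasDim (LeftKernel A) s
  rank-nullity {a} A = rank , nullity , ℕ.≤-antisym r+s≤a a≤r+s
    , (transpose C , rowSpace-basis (transposeFactorization φ))
    , (N , ModuleProperties.IsBasis-resp-≐ (coordinateSpace a) (⟨E⟩⊆ker , ker⊆⟨E⟩) (rowSpace-basis ψ))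
    where
    φ = factorize A
    open FullRankFactorization φ
    open FactorizationProperties φ
    E : Matrix a a
    E = residual C L
    ψ = factorize E
    open FullRankFactorization ψ using () renaming (rank to nullity; R to N; C to T; A≋CR to E≋TN)

    ⟨E⟩⊆kerC : ⟨ E ⟩ ⊆ LeftKernel C
    ⟨E⟩⊆kerC y∈⟨E⟩ = let (x , xE≈y) = ∈⟨⟩⇒·ᵛ y∈⟨E⟩ in
      λ j → trans (sym (·ᵛ-congˡ C xE≈y j)) (residual-· C L LC≋1 x j)

    ⟨E⟩⊆ker : ⟨ E ⟩ ⊆ LeftKernel A
    ⟨E⟩⊆ker {y} y∈⟨E⟩ j = trans (·ᵛ-factor y j) (·ᵛ-≈0ˡ R (⟨E⟩⊆kerC y∈⟨E⟩) j)

    ker⊆⟨E⟩ : LeftKernel A ⊆ ⟨ E ⟩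
    ker⊆⟨E⟩ {x} xA≈0 = ·ᵛ⇒∈⟨⟩ x (residual-fixes C L LC≋1 x
      (λ j → trans (sym (·ᵛ-A-S x j)) (·ᵛ-≈0ˡ S xA≈0 j)))

    split : ∀ {c} (z : Vector Carrier (rank +ℕ nullity)) (X : Matrix rank c) (Y : Matrix nullity c) j →
            (z ·ᵛ (X ++ Y)) j ≈ ((λ i → z (i ↑ˡ nullity)) ·ᵛ X) j + ((λ i → z (rank ↑ʳ i)) ·ᵛ Y) j
    split z X Y j = trans (sum-↑ rank (λ i → z i * (X ++ Y) i j)) (+-cong
      (sum-cong-≋ (λ i → *-congˡ (reflexive (≡.cong (λ v → v j) (lookup-++ˡ X Y i)))))
      (sum-cong-≋ (λ i → *-congˡ (reflexive (≡.cong (λ v → v j) (lookup-++ʳ X Y i))))))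

    a≤r+s : a ≤ rank +ℕ nullity
    -- `T · N` is `1ᴹ - C · L`, so the block product `C · L + T · N` is the identity.
    a≤r+s = rightInvertible⇒≤ (λ i → C i ++ T i) (L ++ N) λ i j → begin
      ((C i ++ T i) ·ᵛ (L ++ N)) j
        ≈⟨ split (C i ++ T i) L N j ⟩
      ((λ l → (C i ++ T i) (l ↑ˡ nullity)) ·ᵛ L) j + ((λ l → (C i ++ T i) (rank ↑ʳ l)) ·ᵛ N) j
        ≈⟨ +-cong (·ᵛ-congˡ L (λ l → reflexive (lookup-++ˡ (C i) (T i) l)) j)
                  (·ᵛ-congˡ N (λ l → reflexive (lookup-++ʳ (C i) (T i) l)) j) ⟩
      (C · L) i j + (T · N) i j
        ≈⟨ +-congˡ (E≋TN i j) ⟨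
      (C · L) i j + (1ᴹ i j - (C · L) i j)
        ≈⟨ +-comm _ _ ⟩
      (1ᴹ i j - (C · L) i j) + (C · L) i j
        ≈⟨ trans (+-assoc _ _ _) (trans (+-congˡ (-‿inverseˡ _)) (+-identityʳ _)) ⟩
      1ᴹ i j ∎
      where open SetoidReasoning setoid

    r+s≤a : rank +ℕ nullity ≤ a
    -- Multiplying a relation by `C` kills the part from `N` and recovers the coefficients of `L`;
    -- once these vanish, independence of `N` does the rest.
    r+s≤a = independent⇒≤ (L ++ N) λ z z≈0 →
      let z₁ = λ i → z (i ↑ˡ nullity)
          z₂ = λ i → z (rank ↑ʳ i)
          sum≈0 : ∀ j → (z₁ ·ᵛ L) j + (z₂ ·ᵛ N) j ≈ 0#
          sum≈0 j = trans (sym (split z L N j)) (z≈0 j)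
          z₂N∈kerC : z₂ ·ᵛ N ∈ LeftKernel C
          z₂N∈kerC = ⟨E⟩⊆kerC (proj₁ (proj₂ (rowSpace-basis ψ)) (·ᵛ⇒∈⟨⟩ z₂ (λ _ → refl)))
          z₁≈0 : z₁ ≈ᵛ 0ᵛ
          z₁≈0 i = begin
            z₁ i                                          ≈⟨ ·-1ʳ z₁ L C LC≋1 i ⟨
            ((z₁ ·ᵛ L) ·ᵛ C) i                            ≈⟨ +-identityʳ _ ⟨
            ((z₁ ·ᵛ L) ·ᵛ C) i + 0#                       ≈⟨ +-congˡ (z₂N∈kerC i) ⟨
            ((z₁ ·ᵛ L) ·ᵛ C) i + ((z₂ ·ᵛ N) ·ᵛ C) i       ≈⟨ +-·ᵛ (z₁ ·ᵛ L) (z₂ ·ᵛ N) C i ⟨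
            ((λ j → (z₁ ·ᵛ L) j + (z₂ ·ᵛ N) j) ·ᵛ C) i    ≈⟨ ·ᵛ-≈0ˡ C sum≈0 i ⟩
            0#                                            ∎
          z₂≈0 : z₂ ≈ᵛ 0ᵛ
          z₂≈0 = independent⇒injective (proj₁ (rowSpace-basis ψ)) z₂ (λ j →
            trans (sym (trans (+-congʳ (·ᵛ-≈0ˡ L z₁≈0 j)) (+-identityˡ _))) (sum≈0 j))
      in λ i → case {z} i z₁≈0 z₂≈0
      where
      open SetoidReasoning setoid
      case : ∀ {z : Vector Carrier (rank +ℕ nullity)} i →
             (∀ i → z (i ↑ˡ nullity) ≈ 0#) → (∀ i → z (rank ↑ʳ i) ≈ 0#) → z i ≈ 0#
      case {z} i z₁≈0 z₂≈0 with splitAt rank i in eq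
      ... | inj₁ j = trans (reflexive (≡.cong z (≡.sym (Fin.splitAt⁻¹-↑ˡ eq)))) (z₁≈0 j)
      ... | inj₂ j = trans (reflexive (≡.cong z (≡.sym (Fin.splitAt⁻¹-↑ʳ eq)))) (z₂≈0 j)

  -- Hyperplanes and their normals

  -- Rank-nullity for the one-column matrix of `u`, whose rank is 1 because a nonzero vector is a
  -- basis of its line.
  Perp-dimension : ∀ {a} (u : Vector Carrier a) → ¬ u ≈ᵛ 0ᵛ → HasDim (Perp u) (pred a)
  Perp-dimension {a} u u≉0 = from-rank-nullity (rank-nullity (column u))
    where
    u-injective : ∀ x → x ∈ LeftKernel (transpose (column u)) → x ≈ᵛ 0ᵛ
    u-injective x xu≈0 zero with ≉0⇒entry u u≉0
    ... | j , uj≉0 with inverse (u j) uj≉0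
    ...   | c , cu≈1 = begin
      x zero                  ≈⟨ *-identityʳ _ ⟨
      x zero * 1#             ≈⟨ *-congˡ (trans (*-comm (u j) c) cu≈1) ⟨
      x zero * (u j * c)      ≈⟨ *-assoc _ _ _ ⟨
      x zero * u j * c        ≈⟨ *-congʳ (trans (sym (+-identityʳ _)) (xu≈0 j)) ⟩
      0# * c                  ≈⟨ zeroˡ c ⟩
      0#                      ∎
      where open SetoidReasoning setoid
    from-rank-nullity : ∃₂ (λ r s → r +ℕ s ≡ a × HasDim ⟨ transpose (column u) ⟩ r ×
                                    HasDim (LeftKernel (column u)) s) → HasDim (Perp u) (pred a)
    from-rank-nullity (r , s , r+s≡a , row-dim , ker-dim) = ≡.subst (HasDim (Perp u))
      (≡.cong pred (≡.trans (≡.cong (_+ℕ s) (≡.sym r≡1)) r+s≡a))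
      (ModuleProperties.HasDim-resp-≐ (coordinateSpace a)
        ((λ x∈ker → x∈ker zero) , (λ xu≈0 _ → xu≈0)) ker-dim)
      where
      r≡1 : r ≡ 1
      r≡1 = HasDim-unique (coordinateSpace a) row-dim
        (transpose (column u) , injective⇒independent {A = transpose (column u)} u-injective , (λ x → x) , (λ x → x))

  -- By rank-nullity the vectors orthogonal to a basis `W` of `H` form a line, and its generator is
  -- the normal; double annihilation shows that `Perp u` is no larger than `H`. `NonZero a` matters:
  -- as `pred 0` is 0, the zero space would otherwise be a hyperplane of itself without a normal.
  hyperplane-normal : ∀ {a} .{{_ : NonZero a}} {H : Pred (Vector Carrier a) 0ℓ} →
                      HasDim H (pred a) → ∃[ u ] ¬ u ≈ᵛ 0ᵛ × H ≐ Perp u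
  hyperplane-normal {a} {H} (W , W-basis) = from-rank-nullity (rank-nullity (transpose W))
    where
    from-basis : ∀ {s} → s ≡ 1 → (N : Matrix s a) → IsBasis (LeftKernel (transpose W)) N →
                 ∃[ u ] ¬ u ≈ᵛ 0ᵛ × H ≐ Perp u
    from-basis ≡.refl N N-basis = u , u≉0 , H⊆ , ⊆H
      where
      module N = ModuleProperties.IsBasisProperties (coordinateSpace a) {v = N} N-basis
      u : Vector Carrier a
      u = N zero
      u≉0 : ¬ u ≈ᵛ 0ᵛ
      u≉0 u≈0 = 1≉0 (independent⇒injective {A = N} N.independent (λ _ → 1#)
        (·ᵛ-≈0ʳ (λ _ → 1#) {N} (λ { zero → u≈0 })) zero)
      W⊆Perp : ∀ i → W i ∈ Perp u
      W⊆Perp i = trans (∙-comm (W i) u) (N.∈-basis zero i)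
      H⊆ : H ⊆ Perp u
      H⊆ x∈H = ModuleProperties.⟨⟩-least (coordinateSpace a) (Perp-isSubspace u) W⊆Perp
        (proj₂ (proj₂ W-basis) x∈H)
      ⊆H : Perp u ⊆ H
      ⊆H {x} xu≈0 = proj₁ (proj₂ W-basis) (let (z , eq) = double-annihilator (transpose W) x ker⊆ in
        ·ᵛ⇒∈⟨⟩ z eq)
        where
        ker⊆ : LeftKernel (transpose W) ⊆ Perp x
        ker⊆ y∈ker = ModuleProperties.⟨⟩-least (coordinateSpace a) (Perp-isSubspace x) {v = N}
          (λ { zero → trans (∙-comm u x) xu≈0 }) (proj₂ (proj₂ N-basis) y∈ker)

    from-rank-nullity : ∃₂ (λ r s → r +ℕ s ≡ a × HasDim ⟨ W ⟩ r × HasDim (LeftKernel (transpose W)) s) →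
                        ∃[ u ] ¬ u ≈ᵛ 0ᵛ × H ≐ Perp u
    from-rank-nullity (r , s , r+s≡a , row-dim , N , N-basis) = from-basis s≡1 N N-basis
      where
      r≡pred-a : r ≡ pred a
      r≡pred-a = HasDim-unique (coordinateSpace a) row-dim (W , proj₁ W-basis , (λ x → x) , (λ x → x))
      s≡1 : s ≡ 1
      s≡1 = ℕ.+-cancelˡ-≡ (pred a) s 1 (≡.trans (≡.cong (_+ℕ s) (≡.sym r≡pred-a))
        (≡.trans r+s≡a (≡.trans (≡.sym (ℕ.suc-pred a)) (ℕ.+-comm 1 (pred a)))))

-- Finite Heyting fields are discrete

module FiniteFieldProperties {N : ℕ} (𝔽 : FiniteField N) where
  open FiniteField 𝔽
  open HeytingField heytingField using (tight; #⇒invertible; invertible⇒#)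
  open Inverse enumeration using (to; from; to-cong; strictlyInverseʳ)

  infix 4 _≈?_

  _≈?_ : ∀ x y → Dec (x ≈ y)
  x ≈? y = map′ to-injective to-cong (to x Fin.≟ to y)
    where
    to-injective : to x ≡ to y → x ≈ y
    to-injective eq = trans (sym (strictlyInverseʳ x))
      (trans (reflexive (≡.cong from eq)) (strictlyInverseʳ y))

  x-0≈x : ∀ x → x - 0# ≈ x
  x-0≈x x = trans (+-congˡ (GroupProperties.ε⁻¹≈ε +-group)) (+-identityʳ x)

  -- `1#` inverts `1# - 0#`, which puts `1#` apart from `0#`; tightness makes this incompatible with
  -- equality.
  1≉0 : ¬ 1# ≈ 0#
  1≉0 1≈0 = proj₂ (tight 1# 0#) 1≈0 (invertible⇒# (1# , eq , eq′))
    where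
    eq′ : (1# - 0#) * 1# ≈ 1#
    eq′ = trans (*-identityʳ _) (x-0≈x 1#)
    eq : 1# * (1# - 0#) ≈ 1#
    eq = trans (*-identityˡ _) (x-0≈x 1#)

  -- Apartness from 0 only follows up to double negation from x ≉ 0; the inverse
  -- is recovered by searching the enumeration.
  inverse : ∀ x → ¬ x ≈ 0# → ∃[ y ] y * x ≈ 1#
  inverse x x≉0 with Fin.any? (λ i → from i * x ≈? 1#)
  ... | yes (i , eq) = from i , eq
  ... | no none = contradiction (proj₁ (tight x 0#) ¬x#0) x≉0
    where
    ¬x#0 : ¬ (HeytingField._#_ heytingField x 0#)
    ¬x#0 x#0 with #⇒invertible x#0
    ... | y , yx≈1 , _ = none (to y ,
      trans (*-cong (strictlyInverseʳ y) (sym (x-0≈x x))) yx≈1)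

  isDiscreteField : IsDiscreteField commutativeRing
  isDiscreteField = record { _≈?_ = _≈?_ ; 1≉0 = 1≉0 ; inverse = inverse }

-- Rank supports and their annihilators

module RankMetricProperties {q m : ℕ} (E : FieldExtension q m) (Γ : OrderedBasis E) where
  open FieldExtension E
  open OrderedBasis Γ using (γ; coordinates) renaming (isBasis to γ-basis)
  open RankMetric E Γ
  open Fᴹ using () renaming (Matrix to Matrixᶠ)
  open Kᴹ using (_≈ᵛ_; _·ᵛ_; _·_; _≋_) renaming (Matrix to Matrixᵏ)

  module LF = FieldLinearAlgebra F.commutativeRing (FiniteFieldProperties.isDiscreteField F)
  module LK = FieldLinearAlgebra K.commutativeRing (FiniteFieldProperties.isDiscreteField K)
  module PF = MatrixProperties F.ring
  module PK = MatrixProperties K.ring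
  open LK using (_∙_; Perp)
  module MF {n} = ModuleProperties (F^ n)
  module MK {n} = ModuleProperties (K^ n)
  module MK/F {n} = ModuleProperties (K^-over-F n)
  module KF = ModuleProperties K-over-F
  module γ = KF.IsBasisProperties γ-basis
  private module Reasoning {a} = SetoidReasoning (PK.vectorSetoid a)

  private variable
    n k d : ℕ

  ιᵛ : Vector F.Carrier n → Vector K.Carrier n
  ιᵛ a i = ι (a i)

  ιᴹ : Matrixᶠ n k → Matrixᵏ n k
  ιᴹ A i = ιᵛ (A i)

  ιᵛ-·ᵛ : (a : Vector F.Carrier n) (A : Matrixᶠ n k) → ιᵛ (a Fᴹ.·ᵛ A) ≈ᵛ ιᵛ a ·ᵛ ιᴹ A
  ιᵛ-·ᵛ a A j = K.trans (ι-sum (λ i → a i F.* A i j))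
    (ΣK.sum-cong-≋ (λ i → ι.*-homo (a i) (A i j)))

  restrict-isSubspace : {P : Pred (Vector K.Carrier k) 0ℓ} → K^n.IsSubspace P → K^n/F.IsSubspace P
  restrict-isSubspace P = record
    { resp = P.resp ; 0-closed = P.0-closed ; +-closed = P.+-closed
    ; *-closed = λ a → P.*-closed (ι a) }
    where module P = K^n.IsSubspace P

  ∙⇒∈LeftKernel : ∀ (v : Vector K.Carrier n) a → ιᵛ a ∙ v K.≈ K.0# → a ∈ LF.LeftKernel (Γ-matrix v)
  ∙⇒∈LeftKernel v a a∙v≈0 = γ.independent (a Fᴹ.·ᵛ Γ-matrix v) (begin
    KL.lincomb (a Fᴹ.·ᵛ Γ-matrix v) γ
      ≈⟨ KF.lincomb-·ᵛ a (Γ-matrix v) γ ⟩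
    KL.lincomb a (λ i → KL.lincomb (coordinates (v i)) γ)
      ≈⟨ KF.lincomb-congʳ a (λ i → γ.lincomb-coords {v i} _) ⟩
    -- The scalar action of `F` on `K` goes through `ι`, so this combination unfolds to `ιᵛ a ∙ v`.
    KL.lincomb a v
      ≈⟨ a∙v≈0 ⟩
    K.0# ∎)
    where
    module KL = LinearAlgebra K-over-F
    open SetoidReasoning K.setoid

  ∈LeftKernel⇒∙ : ∀ (v : Vector K.Carrier n) a → a ∈ LF.LeftKernel (Γ-matrix v) → ιᵛ a ∙ v K.≈ K.0#
  ∈LeftKernel⇒∙ v a a∈ker = begin
    KL.lincomb a v
      ≈⟨ KF.lincomb-congʳ a (λ i → γ.lincomb-coords {v i} _) ⟨
    KL.lincomb a (λ i → KL.lincomb (coordinates (v i)) γ)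
      ≈⟨ KF.lincomb-·ᵛ a (Γ-matrix v) γ ⟨
    KL.lincomb (a Fᴹ.·ᵛ Γ-matrix v) γ
      ≈⟨ KF.lincomb-congˡ γ a∈ker ⟩
    KL.lincomb PF.0ᵛ γ
      ≈⟨ KF.lincomb-0ᵛ γ ⟩
    K.0# ∎
    where
    module KL = LinearAlgebra K-over-F
    open SetoidReasoning K.setoid

  rankSupport⊆Perp : ∀ (v : Vector K.Carrier n) a → ιᵛ a ∙ v K.≈ K.0# → rankSupport v ⊆ LF.Perp a
  rankSupport⊆Perp v a a∙v≈0 = MF.⟨⟩-least (LF.Perp-isSubspace a)
    (λ l → F.trans (LF.∙-comm _ a) (∙⇒∈LeftKernel v a a∙v≈0 l))

  rankSupport-⊆⇒ : ∀ (v v′ : Vector K.Carrier n) → rankSupport v′ ⊆ rankSupport v →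
                   ∀ a → ιᵛ a ∙ v K.≈ K.0# → ιᵛ a ∙ v′ K.≈ K.0#
  rankSupport-⊆⇒ v v′ σ⊆ a a∙v≈0 = ∈LeftKernel⇒∙ v′ a (λ l →
    F.trans (LF.∙-comm a _) (rankSupport⊆Perp v a a∙v≈0 (σ⊆ (MF.∈⟨⟩ (transpose (Γ-matrix v′)) l))))

  ⇒rankSupport-⊆ : ∀ (v v′ : Vector K.Carrier n) →
                   (∀ a → ιᵛ a ∙ v K.≈ K.0# → ιᵛ a ∙ v′ K.≈ K.0#) → rankSupport v′ ⊆ rankSupport v
  ⇒rankSupport-⊆ v v′ ann = MF.⟨⟩-least (MF.⟨⟩-isSubspace (transpose (Γ-matrix v))) (λ l →
    let (z , eq) = LF.double-annihilator (Γ-matrix v) (transpose (Γ-matrix v′) l)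
          (λ {a} a∈ker → ∙⇒∈LeftKernel v′ a (ann a (∈LeftKernel⇒∙ v a a∈ker)) l)
    in LF.·ᵛ⇒∈⟨⟩ z eq)

  Perp-isHyperplane : (u : Vector K.Carrier k) → ¬ IsZero u → IsHyperplane (Perp u)
  Perp-isHyperplane u u≉0 = record
    { isSubspace = LK.Perp-isSubspace u ; dimension = LK.Perp-dimension u u≉0 }

  -- Generator matrices: nondegeneracy, spanning and sections

  module Columns (G : Matrixᵏ k n) where

    col : Vector F.Carrier n → Vector K.Carrier k
    col a = K^n/F.lincomb a (transpose G)

    col≈ : ∀ a → col a ≈ᵛ ιᵛ a ·ᵛ transpose G
    col≈ a = LK.lincomb≈·ᵛ (ιᵛ a) (transpose G)

    col-∙ : ∀ a u → col a ∙ u K.≈ ιᵛ a ∙ (u ·ᵛ G)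
    col-∙ a u = K.trans (LK.∙-congˡ u (col≈ a)) (LK.∙-adjoint (ιᵛ a) (transpose G) u)

  -- These are predicates on bare carriers, so that they apply before a carrier has been completed
  -- to a `Code` or a `System`; the predicates on records unfold to them.
  NondegenerateSpace : Pred (Pred (Vector K.Carrier n) 0ℓ) 0ℓ
  NondegenerateSpace C = F^n.Span (λ x → ∃[ v ] v ∈ C × x ∈ rankSupport v) ≐ U

  MinimalSpace : Pred (Pred (Vector K.Carrier n) 0ℓ) 0ℓ
  MinimalSpace C = ∀ v v′ → v ∈ C → v′ ∈ C →
                   rankSupport v′ ⊆ rankSupport v → ∃[ α ] v′ ≈ᵛ (λ i → α K.* v i)

  CuttingSpace : Pred (Pred (Vector K.Carrier k) 0ℓ) (lsuc 0ℓ)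
  CuttingSpace S = ∀ H H′ → IsHyperplane H → IsHyperplane H′ → (S ∩ H) ⊆ (S ∩ H′) → H ≐ H′

  module _ {C : Pred (Vector K.Carrier n) 0ℓ} {G : Matrixᵏ k n} (C-basis : K^n.IsBasis C G) where
    open Columns G
    private module C = MK.IsBasisProperties {v = G} C-basis

    ·ᵛ∈ : ∀ u → u ·ᵛ G ∈ C
    ·ᵛ∈ u = proj₁ (proj₂ C-basis) (LK.·ᵛ⇒∈⟨⟩ {A = G} u (λ _ → K.refl))

    message : ∀ {v} → v ∈ C → ∃[ u ] u ·ᵛ G ≈ᵛ v
    message v∈C = LK.∈⟨⟩⇒·ᵛ {A = G} (proj₂ (proj₂ C-basis) v∈C)

    message-injective : ∀ u → u ·ᵛ G ≈ᵛ PK.0ᵛ → u ≈ᵛ PK.0ᵛ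
    message-injective = LK.independent⇒injective {A = G} C.independent

    ·ᵛ-injective : ∀ u u′ → u ·ᵛ G ≈ᵛ u′ ·ᵛ G → u ≈ᵛ u′
    ·ᵛ-injective u u′ uG≈u′G = PK.≈0-⊖ᵛ (message-injective (u PK.⊖ᵛ u′)
      (λ j → K.trans (PK.⊖ᵛ-·ᵛ u u′ G j) (PK.⊖ᵛ-≈0 uG≈u′G j)))

    -- An F-relation `a` between the columns annihilates every codeword, hence every rank support.
    -- As the supports span, `a` is orthogonal to each unit vector.
    nondegenerate⇒independent : NondegenerateSpace C → K^n/F.LinearlyIndependent (transpose G)
    nondegenerate⇒independent (_ , span) a col≈0 i =
      F.trans (F.sym (LF.1ᴹ-∙ i a)) (MF.Span-least (LF.Perp-isSubspace a) support⊆ (span {Fᴹ.1ᴹ i} _))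
      where
      support⊆ : (λ x → ∃[ v ] v ∈ C × x ∈ rankSupport v) ⊆ LF.Perp a
      support⊆ (v , v∈C , x∈σ) = let (u , uG≈v) = message v∈C in
        rankSupport⊆Perp v a (begin
          ιᵛ a ∙ v          ≈⟨ LK.∙-congʳ (ιᵛ a) uG≈v ⟨
          ιᵛ a ∙ (u ·ᵛ G)   ≈⟨ col-∙ a u ⟨
          col a ∙ u         ≈⟨ LK.∙-congˡ u col≈0 ⟩
          PK.0ᵛ ∙ u         ≈⟨ PK.·ᵛ-zeroˡ (LK.column u) zero ⟩
          K.0#              ∎) x∈σ
        where open SetoidReasoning K.setoid

    -- The `k ℕ.* m` columns of the matrices `Γ-matrix (G i)` already span: a vector orthogonal to
    -- all of them annihilates each row of `G`, so it is a relation between the columns of `G` and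
    -- vanishes. Double annihilation then reaches every `b`.
    independent⇒nondegenerate : K^n/F.LinearlyIndependent (transpose G) → NondegenerateSpace C
    independent⇒nondegenerate independent = _ , λ {b} _ →
      k ℕ.* m , columns , columns∈ , LF.·ᵛ⇒∈⟨⟩ {A = columns} (proj₁ (dual b)) (proj₂ (dual b))
      where
      columns : Matrixᶠ (k ℕ.* m) n
      columns t = transpose (Γ-matrix (G (Fin.quotient m t))) (Fin.remainder {k} m t)
      columns∈ : ∀ t → ∃[ v ] v ∈ C × columns t ∈ rankSupport v
      columns∈ t = G (Fin.quotient m t) , C.∈-basis (Fin.quotient m t)
        , MF.∈⟨⟩ (transpose (Γ-matrix (G (Fin.quotient m t)))) (Fin.remainder {k} m t)
      annihilator-zero : ∀ a → a ∈ LF.LeftKernel (transpose columns) → a Fᴹ.≈ᵛ PF.0ᵛ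
      annihilator-zero a a∈ker = independent a (λ i → K.trans (col≈ a i)
        (∈LeftKernel⇒∙ (G i) a (λ l → ≡.subst
          (λ (i , l) → a LF.∙ (λ j → Γ-matrix (G i) j l) F.≈ F.0#)
          (Fin.remQuot-combine i l) (a∈ker (Fin.combine i l)))))
      dual : ∀ b → ∃[ z ] z Fᴹ.·ᵛ columns Fᴹ.≈ᵛ b
      dual b = LF.double-annihilator (transpose columns) b (λ {a} a∈ker →
        F.trans (LF.∙-congˡ b (annihilator-zero a a∈ker)) (PF.·ᵛ-zeroˡ (LF.column b) zero))

    -- Independence of the rows leaves only zero in the left kernel of `G`, so double annihilation
    -- puts no condition on `b`.
    columns-span : K^n.Span K^n/F.⟨ transpose G ⟩ ≐ U
    columns-span = _ , λ {b} _ → n , transpose G , MK/F.∈⟨⟩ (transpose G) ,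
      (let (z , eq) = LK.double-annihilator G b (λ {u} uG≈0 →
             K.trans (LK.∙-congˡ b (message-injective u uG≈0)) (PK.·ᵛ-zeroˡ (LK.column b) zero))
       in LK.·ᵛ⇒∈⟨⟩ z eq)

  module _ {S : Pred (Vector K.Carrier k) 0ℓ} {G : Matrixᵏ k n}
           (S-basis : K^n/F.IsBasis S (transpose G)) where
    open Columns G
    private module S = MK/F.IsBasisProperties {v = transpose G} S-basis

    S⊆Perp : ∀ u → u ·ᵛ G ≈ᵛ PK.0ᵛ → S ⊆ Perp u
    S⊆Perp u uG≈0 {x} x∈S = begin
      x ∙ u                              ≈⟨ LK.∙-congˡ u (S.lincomb-coords x∈S) ⟨
      col (S.coords x∈S) ∙ u             ≈⟨ col-∙ (S.coords x∈S) u ⟩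
      ιᵛ (S.coords x∈S) ∙ (u ·ᵛ G)       ≈⟨ LK.∙-zeroʳ (ιᵛ (S.coords x∈S)) uG≈0 ⟩
      K.0#                               ∎
      where open SetoidReasoning K.setoid

    -- A relation `u` between the rows confines `S`, and with it the K-span of `S`, to `Perp u`; so
    -- every unit vector is orthogonal to `u`.
    spanning⇒independent : K^n.Span S ≐ U → K^n.LinearlyIndependent G
    spanning⇒independent (_ , span) = LK.injective⇒independent {A = G} λ u uG≈0 i →
      K.trans (K.sym (LK.1ᴹ-∙ i u))
        (MK.Span-least (LK.Perp-isSubspace u) (S⊆Perp u uG≈0) (span {Kᴹ.1ᴹ i} _))

    -- The map `col` carries a kernel basis to a basis of the section. The codeword `v` is kept
    -- apart from `u ·ᵛ G` because `Γ-matrix` is formed from a given representative; no rank then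
    -- has to be transported along `≈ᵛ`.
    section-dimension : ∀ {s} u v → u ·ᵛ G ≈ᵛ v → F^n.HasDim (LF.LeftKernel (Γ-matrix v)) s →
                        K^n/F.HasDim (S ∩ Perp u) s
    section-dimension {s} u v uG≈v (N , N-basis) = (λ j → col (N j)) , independent , ⊆section , section⊆
      where
      module N = MF.IsBasisProperties {v = N} N-basis
      lincomb-col : ∀ b → K^n/F.lincomb b (λ j → col (N j)) ≈ᵛ col (b Fᴹ.·ᵛ N)
      lincomb-col b i = K.sym (MK/F.lincomb-·ᵛ b N (transpose G) i)
      independent : K^n/F.LinearlyIndependent (λ j → col (N j))
      independent b b≈0 = LF.independent⇒injective {A = N} N.independent b
        (S.independent (b Fᴹ.·ᵛ N) (λ i → K.trans (K.sym (lincomb-col b i)) (b≈0 i)))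
      col∈section : ∀ j → col (N j) ∈ S ∩ Perp u
      col∈section j = S.lincomb∈ (N j) , K.trans (col-∙ (N j) u)
        (K.trans (LK.∙-congʳ (ιᵛ (N j)) uG≈v) (∈LeftKernel⇒∙ v (N j) (N.∈-basis j)))
      ⊆section : K^n/F.⟨ (λ j → col (N j)) ⟩ ⊆ S ∩ Perp u
      ⊆section {x} (b , eq) =
        proj₁ (proj₂ S-basis) (b Fᴹ.·ᵛ N , λ i → K.trans (K.sym (lincomb-col b i)) (eq i)) ,
        MK/F.⟨⟩-least (restrict-isSubspace (LK.Perp-isSubspace u)) (λ j → proj₂ (col∈section j)) {x} (b , eq)
      section⊆ : S ∩ Perp u ⊆ K^n/F.⟨ (λ j → col (N j)) ⟩
      section⊆ {x} (x∈S , xu≈0) = b , λ i → begin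
        K^n/F.lincomb b (λ j → col (N j)) i    ≈⟨ lincomb-col b i ⟩
        col (b Fᴹ.·ᵛ N) i                      ≈⟨ MK/F.lincomb-congˡ (transpose G) (proj₂ b,eq) i ⟩
        col a i                                ≈⟨ S.lincomb-coords x∈S i ⟩
        x i                                    ∎
        where
        open SetoidReasoning K.setoid
        a = S.coords x∈S
        a∈ker : a ∈ LF.LeftKernel (Γ-matrix v)
        a∈ker = ∙⇒∈LeftKernel v a (begin
          ιᵛ a ∙ v          ≈⟨ LK.∙-congʳ (ιᵛ a) uG≈v ⟨
          ιᵛ a ∙ (u ·ᵛ G)   ≈⟨ col-∙ a u ⟨
          col a ∙ u         ≈⟨ LK.∙-congˡ u (S.lincomb-coords x∈S) ⟩
          x ∙ u             ≈⟨ xu≈0 ⟩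
          K.0#              ∎)
        b,eq = LF.∈⟨⟩⇒·ᵛ {A = N} (proj₂ (proj₂ N-basis) a∈ker)
        b = proj₁ b,eq

    rank-section : ∀ u v → u ·ᵛ G ≈ᵛ v →
                   ∃₂ λ r s → r +ℕ s ≡ n × HasRank v r × K^n/F.HasDim (S ∩ Perp u) s
    rank-section u v uG≈v =
      let (r , s , r+s≡n , row-dim , ker-dim) = LF.rank-nullity (Γ-matrix v)
      in r , s , r+s≡n , row-dim , section-dimension u v uG≈v ker-dim

    rank+section≡n : ∀ {r s} u v → u ·ᵛ G ≈ᵛ v → HasRank v r → K^n/F.HasDim (S ∩ Perp u) s → r +ℕ s ≡ n
    rank+section≡n u v uG≈v v-rank section-dim =
      let (r , s , r+s≡n , v-rank′ , section-dim′) = rank-section u v uG≈v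
      in ≡.trans (≡.cong₂ _+ℕ_ (LF.HasDim-unique (F^ n) v-rank v-rank′)
                               (LF.HasDim-unique (K^-over-F k) section-dim section-dim′)) r+s≡n

  -- Minimum rank and largest hyperplane section

  MinimumRank : Pred (Vector K.Carrier n) 0ℓ → ℕ → Set
  MinimumRank C d = IsMinimum (λ r → ∃[ v ] v ∈ C × ¬ IsZero v × HasRank v r) d

  Distance : ℕ → Pred (Vector K.Carrier k) 0ℓ → ℕ → Set₁
  Distance n S d = ∃[ e ] d ≡ n ∸ e × IsMaximum (λ s → ∃[ H ] IsHyperplane H × K^n/F.HasDim (S ∩ H) s) e

  ∩-congʳ : {S H H′ : Pred (Vector K.Carrier k) 0ℓ} → H ≐ H′ → (S ∩ H) ≐ (S ∩ H′)
  ∩-congʳ (H⊆ , ⊆H) = (λ (s , h) → s , H⊆ h) , (λ (s , h) → s , ⊆H h)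

  normal : .{{_ : NonZero k}} {H : Pred (Vector K.Carrier k) 0ℓ} → IsHyperplane H →
           ∃[ u ] ¬ IsZero u × H ≐ Perp u
  normal H-hyperplane = LK.hyperplane-normal (IsHyperplane.dimension H-hyperplane)

  module _ .{{_ : NonZero k}} {C : Pred (Vector K.Carrier n) 0ℓ} {S : Pred (Vector K.Carrier k) 0ℓ}
           {G : Matrixᵏ k n} (C-basis : K^n.IsBasis C G)
           (S-basis : K^n/F.IsBasis S (transpose G)) where
    open Columns G
    private module S = MK/F.IsBasisProperties {v = transpose G} S-basis

    codeword≉0 : ∀ u → ¬ IsZero u → ¬ IsZero (u ·ᵛ G)
    codeword≉0 u u≉0 uG≈0 = u≉0 (message-injective C-basis u uG≈0)

    message≉0 : ∀ u {v} → u ·ᵛ G ≈ᵛ v → ¬ IsZero v → ¬ IsZero u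
    message≉0 u uG≈v v≉0 u≈0 = v≉0 (λ i → K.trans (K.sym (uG≈v i)) (PK.·ᵛ-≈0ˡ G u≈0 i))

    -- Every hyperplane has a nonzero normal `u′`, hence a nonzero codeword `u′ ·ᵛ G` of rank at
    -- least `d`. Rank and section having constant sum, the codeword of rank `d` gives the largest
    -- section.
    minimumRank⇒distance : MinimumRank C d → Distance n S d
    minimumRank⇒distance {d} ((v , v∈C , v≉0 , v-rank) , minimal) =
      let (u , uG≈v) = message C-basis v∈C
          (r , s , r+s≡n , v-rank′ , section-dim) = rank-section S-basis u v uG≈v
          d+s≡n = rank+section≡n S-basis u v uG≈v v-rank section-dim
      -- From `d +ℕ s ≡ n` the truncated difference `n ∸ s` is exactly `d`.
      in s , ≡.trans (≡.sym (ℕ.m+n∸n≡m d s)) (≡.cong (_∸ s) d+s≡n)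
        , (Perp u , Perp-isHyperplane u (message≉0 u uG≈v v≉0) , section-dim)
        , λ b (H , H-hyperplane , H-dim) →
            let (u′ , u′≉0 , H≐Perp) = normal H-hyperplane
                v′ = u′ ·ᵛ G
                (r′ , s′ , r′+s′≡n , v′-rank , section-dim′) = rank-section S-basis u′ v′ (λ _ → K.refl)
                b≡s′ = LF.HasDim-unique (K^-over-F k) (MK/F.HasDim-resp-≐ (∩-congʳ {S = S} H≐Perp) H-dim) section-dim′
                d≤r′ = minimal r′ (v′ , ·ᵛ∈ C-basis u′ , codeword≉0 u′ u′≉0 , v′-rank)
            in ℕ.+-cancelˡ-≤ d b s (≤-of d≤r′ b≡s′ r′+s′≡n d+s≡n)
      where
      ≤-of : ∀ {r b s s′} → d ≤ r → b ≡ s′ → r +ℕ s′ ≡ n → d +ℕ s ≡ n → d +ℕ b ≤ d +ℕ s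
      ≤-of {r} {b} {s} {s′} d≤r ≡.refl r+s′≡n d+s≡n = begin
        d +ℕ b   ≤⟨ ℕ.+-monoˡ-≤ b d≤r ⟩
        r +ℕ b   ≡⟨ ≡.trans r+s′≡n (≡.sym d+s≡n) ⟩
        d +ℕ s   ∎
        where open ℕ.≤-Reasoning

    distance⇒minimumRank : Distance n S d → MinimumRank C d
    distance⇒minimumRank {d} (e , d≡n∸e , (H , H-hyperplane , H-dim) , maximal) =
      let (u , u≉0 , H≐Perp) = normal H-hyperplane
          v = u ·ᵛ G
          (r , s , r+s≡n , v-rank , section-dim) = rank-section S-basis u v (λ _ → K.refl)
          e≡s = LF.HasDim-unique (K^-over-F k) (MK/F.HasDim-resp-≐ (∩-congʳ {S = S} H≐Perp) H-dim) section-dim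
          r≡d : r ≡ d
          -- Since `e` is the dimension `s` of an actual section, `n ∸ e` is not truncated and
          -- equals the rank `r`.
          r≡d = ≡.trans (≡.sym (ℕ.m+n∸n≡m r s)) (≡.trans (≡.cong₂ _∸_ r+s≡n (≡.sym e≡s)) (≡.sym d≡n∸e))
      in (v , ·ᵛ∈ C-basis u , codeword≉0 u u≉0 , ≡.subst (HasRank v) r≡d v-rank)
        , λ b (v′ , v′∈C , v′≉0 , v′-rank) →
            let (u′ , u′G≈v′) = message C-basis v′∈C
                (_ , s′ , _ , _ , section-dim′) = rank-section S-basis u′ v′ u′G≈v′
                b+s′≡n = rank+section≡n S-basis u′ v′ u′G≈v′ v′-rank section-dim′
                s′≤e = maximal s′ (Perp u′ , Perp-isHyperplane u′ (message≉0 u′ u′G≈v′ v′≉0) , section-dim′)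
            in ≡.subst (_≤ b) (≡.sym d≡n∸e) (ℕ.m≤n+o⇒m∸n≤o n e (begin
                 n          ≡⟨ b+s′≡n ⟨
                 b +ℕ s′    ≤⟨ ℕ.+-monoʳ-≤ b s′≤e ⟩
                 b +ℕ e     ≡⟨ ℕ.+-comm b e ⟩
                 e +ℕ b     ∎))
      where open ℕ.≤-Reasoning

    -- Minimal codes and cutting systems

    section-⊆⇒ : ∀ u u′ → (S ∩ Perp u) ⊆ Perp u′ →
                 ∀ a → ιᵛ a ∙ (u ·ᵛ G) K.≈ K.0# → ιᵛ a ∙ (u′ ·ᵛ G) K.≈ K.0#
    section-⊆⇒ u u′ section⊆ a a∙uG≈0 = K.trans (K.sym (col-∙ a u′))
      (section⊆ (S.lincomb∈ a , K.trans (col-∙ a u) a∙uG≈0))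

    ⇒section-⊆ : ∀ u u′ → (∀ a → ιᵛ a ∙ (u ·ᵛ G) K.≈ K.0# → ιᵛ a ∙ (u′ ·ᵛ G) K.≈ K.0#) →
                 (S ∩ Perp u) ⊆ Perp u′
    ⇒section-⊆ u u′ ann {x} (x∈S , xu≈0) = begin
      x ∙ u′             ≈⟨ LK.∙-congˡ u′ (S.lincomb-coords x∈S) ⟨
      col a ∙ u′         ≈⟨ col-∙ a u′ ⟩
      ιᵛ a ∙ (u′ ·ᵛ G)   ≈⟨ ann a (K.trans (K.sym (col-∙ a u))
                              (K.trans (LK.∙-congˡ u (S.lincomb-coords x∈S)) xu≈0)) ⟩
      K.0#               ∎
      where
      open SetoidReasoning K.setoid
      a = S.coords x∈S

    Perp-⊆ : ∀ c {u u′ : Vector K.Carrier k} → u′ ≈ᵛ (λ i → c K.* u i) → Perp u ⊆ Perp u′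
    Perp-⊆ c {u} {u′} u′≈cu {x} xu≈0 = begin
      x ∙ u′                      ≈⟨ LK.∙-comm x u′ ⟩
      u′ ∙ x                      ≈⟨ LK.∙-congˡ x u′≈cu ⟩
      (λ i → c K.* u i) ∙ x       ≈⟨ PK.*-·ᵛ c u (LK.column x) zero ⟩
      c K.* (u ∙ x)               ≈⟨ K.*-congˡ (K.trans (LK.∙-comm u x) xu≈0) ⟩
      c K.* K.0#                  ≈⟨ K.zeroʳ c ⟩
      K.0#                        ∎
      where open SetoidReasoning K.setoid

    minimal⇒cutting : MinimalSpace C → CuttingSpace S
    minimal⇒cutting minimal H H′ H-hyperplane H′-hyperplane section⊆ =
      let (u , u≉0 , H≐) = normal H-hyperplane
          (u′ , u′≉0 , H′≐) = normal H′-hyperplane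
          σ⊆ = ⇒rankSupport-⊆ (u ·ᵛ G) (u′ ·ᵛ G) (section-⊆⇒ u u′
                 (λ (x∈S , xu≈0) → proj₁ H′≐ (proj₂ (section⊆ (x∈S , proj₂ H≐ xu≈0)))))
          (α , u′G≈αuG) = minimal (u ·ᵛ G) (u′ ·ᵛ G) (·ᵛ∈ C-basis u) (·ᵛ∈ C-basis u′) σ⊆
          u′≈αu = ·ᵛ-injective C-basis u′ (λ i → α K.* u i)
            (λ j → K.trans (u′G≈αuG j) (K.sym (PK.*-·ᵛ α u G j)))
          -- Proportionality alone gives one inclusion of hyperplanes. The normal `u′` being nonzero
          -- makes `α` invertible, which gives the other.
          α≉0 : ¬ α K.≈ K.0#
          α≉0 = λ α≈0 → u′≉0 (λ i → K.trans (u′≈αu i) (K.trans (K.*-congʳ α≈0) (K.zeroˡ (u i))))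
          (β , βα≈1) = FiniteFieldProperties.inverse K α α≉0
          u≈βu′ : u ≈ᵛ (λ i → β K.* u′ i)
          u≈βu′ = λ i → K.sym (K.trans (K.*-congˡ (u′≈αu i)) (K.trans (K.sym (K.*-assoc β α (u i)))
            (K.trans (K.*-congʳ βα≈1) (K.*-identityˡ (u i)))))
      in (λ x∈H → proj₂ H′≐ (Perp-⊆ α u′≈αu (proj₁ H≐ x∈H)))
       , (λ x∈H′ → proj₂ H≐ (Perp-⊆ β u≈βu′ (proj₁ H′≐ x∈H′)))

    cutting⇒minimal : CuttingSpace S → MinimalSpace C
    cutting⇒minimal cutting v v′ v∈C v′∈C σ⊆ with LK.≈ᵛ? v′ PK.0ᵛ
    -- A zero `v′` has no hyperplane attached to it; the scalar 0 settles this case for any `v`.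
    ... | yes v′≈0 = K.0# , λ i → K.trans (v′≈0 i) (K.sym (K.zeroˡ (v i)))
    ... | no v′≉0 = proj₁ α,eq , λ j → begin
        v′ j                                   ≈⟨ u′G≈v′ j ⟨
        (u′ ·ᵛ G) j                            ≈⟨ PK.·ᵛ-congˡ G (proj₂ α,eq) j ⟨
        ((λ i → proj₁ α,eq K.* u i) ·ᵛ G) j    ≈⟨ PK.*-·ᵛ (proj₁ α,eq) u G j ⟩
        proj₁ α,eq K.* (u ·ᵛ G) j              ≈⟨ K.*-congˡ (uG≈v j) ⟩
        proj₁ α,eq K.* v j                     ∎
      where
      open SetoidReasoning K.setoid
      u = proj₁ (message C-basis v∈C)
      uG≈v = proj₂ (message C-basis v∈C)
      u′ = proj₁ (message C-basis v′∈C)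
      u′G≈v′ = proj₂ (message C-basis v′∈C)
      ann : ∀ a → ιᵛ a ∙ v K.≈ K.0# → ιᵛ a ∙ v′ K.≈ K.0#
      ann = rankSupport-⊆⇒ v v′ σ⊆
      v≉0 : ¬ IsZero v
      -- Were `v` zero, every `a` would annihilate it and hence `v′`; the unit vectors then read off
      -- that `v′` is zero.
      v≉0 v≈0 = v′≉0 (λ i → begin
        v′ i                   ≈⟨ LK.1ᴹ-∙ i v′ ⟨
        Kᴹ.1ᴹ i ∙ v′           ≈⟨ LK.∙-congˡ v′ (ι-1ᴹ i) ⟨
        ιᵛ (Fᴹ.1ᴹ i) ∙ v′      ≈⟨ ann (Fᴹ.1ᴹ i) (LK.∙-zeroʳ (ιᵛ (Fᴹ.1ᴹ i)) v≈0) ⟩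
        K.0#                   ∎)
      Perp≐ : Perp u ≐ Perp u′
      Perp≐ = cutting (Perp u) (Perp u′)
        (Perp-isHyperplane u (message≉0 u uG≈v v≉0)) (Perp-isHyperplane u′ (message≉0 u′ u′G≈v′ v′≉0))
        (λ (x∈S , xu≈0) → x∈S , ⇒section-⊆ u u′ (λ a a∙uG≈0 →
          K.trans (LK.∙-congʳ (ιᵛ a) u′G≈v′) (ann a (K.trans (LK.∙-congʳ (ιᵛ a) (λ j → K.sym (uG≈v j))) a∙uG≈0)))
          (x∈S , xu≈0))
      α,eq : ∃[ α ] (λ i → α K.* u i) ≈ᵛ u′
      -- The left kernel of `column u` is `Perp u`, so double annihilation makes `u′` a multiple of
      -- `u` with factor `z zero`.
      α,eq = let (z , eq) = LK.double-annihilator (LK.column u) u′ (λ xu≈0 → proj₁ Perp≐ (xu≈0 zero))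
        in z zero , λ i → K.trans (K.sym (K.+-identityʳ _)) (eq i)

  -- Both equivalences as a relation between matrices

  -- `Q` changes the basis of the code but acts on the system as an automorphism; `B` acts on the
  -- code as an equivalence but only changes the F-basis of the system. Each side thus sees one
  -- factor as a choice and the other as a map.
  record Related (G G′ : Matrixᵏ k n) : Set where
    field
      Q Q⁻ : Matrixᵏ k k
      B B⁻ : Matrixᶠ n n
      QQ⁻≋1 : Q · Q⁻ ≋ Kᴹ.1ᴹ
      Q⁻Q≋1 : Q⁻ · Q ≋ Kᴹ.1ᴹ
      BB⁻≋1 : B Fᴹ.· B⁻ Fᴹ.≋ Fᴹ.1ᴹ
      B⁻B≋1 : B⁻ Fᴹ.· B Fᴹ.≋ Fᴹ.1ᴹ
      G′≋QGB : G′ ≋ Q · (G · ιᴹ B)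

  ⊙-cancel : {A A⁻ : Matrixᶠ n n} → A Fᴹ.· A⁻ Fᴹ.≋ Fᴹ.1ᴹ →
             ∀ (v : Vector K.Carrier n) → (v ⊙ A) ⊙ A⁻ ≈ᵛ v
  ⊙-cancel {A = A} {A⁻} AA⁻≋1 v = ≈ᵛ-trans (⊙-assoc v A A⁻) (⊙-identityʳ v (A Fᴹ.· A⁻) AA⁻≋1)

  ⊙-injective : {A A⁻ : Matrixᶠ n n} → A Fᴹ.· A⁻ Fᴹ.≋ Fᴹ.1ᴹ →
                ∀ (v w : Vector K.Carrier n) → v ⊙ A ≈ᵛ w ⊙ A → v ≈ᵛ w
  ⊙-injective {A = A} {A⁻} AA⁻≋1 v w vA≈wA j = K.trans (K.sym (⊙-cancel {A = A} {A⁻} AA⁻≋1 v j))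
    (K.trans (⊙-cong A⁻ vA≈wA j) (⊙-cancel {A = A} {A⁻} AA⁻≋1 w j))

  -- `Q` and `P` are chosen independently, from preimages of the rows of `G′` and from images of the
  -- rows of `G`. They are mutually inverse because messages are determined by their codewords,
  -- after cancelling `A` in one of the two cases.
  CodeEquivalent⇒Related : {C C′ : Pred (Vector K.Carrier n) 0ℓ} {G G′ : Matrixᵏ k n} →
                           K^n.IsBasis C G → K^n.IsBasis C′ G′ → CodeEquivalent C C′ → Related G G′
  CodeEquivalent⇒Related {n = n} {k} {C} {C′} {G} {G′} C-basis C′-basis (A , (A⁻ , A⁻A≋1 , AA⁻≋1) , C′⊆ , ⊆C′) = record
    { Q = Q ; Q⁻ = P ; B = A ; B⁻ = A⁻
    ; QQ⁻≋1 = λ i → ·ᵛ-injective C′-basis (Q i ·ᵛ P) (Kᴹ.1ᴹ i) (begin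
        (Q i ·ᵛ P) ·ᵛ G′              ≈⟨ Kᴹ.·ᵛ-assoc (Q i) P G′ ⟩
        Q i ·ᵛ (P · G′)               ≈⟨ PK.·ᵛ-congʳ (Q i) PG′≋GA ⟩
        Q i ·ᵛ (G · ιᴹ A)             ≈⟨ G′≋QGA i ⟨
        G′ i                          ≈⟨ PK.·ᵛ-identityˡ i G′ ⟨
        Kᴹ.1ᴹ i ·ᵛ G′                 ∎)
    ; Q⁻Q≋1 = λ i → ·ᵛ-injective C-basis (P i ·ᵛ Q) (Kᴹ.1ᴹ i)
        (⊙-injective {A = A} {A⁻} AA⁻≋1 ((P i ·ᵛ Q) ·ᵛ G) (Kᴹ.1ᴹ i ·ᵛ G) (begin
          ((P i ·ᵛ Q) ·ᵛ G) ⊙ A       ≈⟨ Kᴹ.·ᵛ-assoc (P i ·ᵛ Q) G (ιᴹ A) ⟩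
          (P i ·ᵛ Q) ·ᵛ (G · ιᴹ A)    ≈⟨ Kᴹ.·ᵛ-assoc (P i) Q (G · ιᴹ A) ⟩
          P i ·ᵛ (Q · (G · ιᴹ A))     ≈⟨ PK.·ᵛ-congʳ (P i) G′≋QGA ⟨
          P i ·ᵛ G′                   ≈⟨ PG′≋GA i ⟩
          G i ⊙ A                     ≈⟨ ⊙-cong A (PK.·ᵛ-identityˡ i G) ⟨
          (Kᴹ.1ᴹ i ·ᵛ G) ⊙ A          ∎))
    ; BB⁻≋1 = AA⁻≋1 ; B⁻B≋1 = A⁻A≋1 ; G′≋QGB = G′≋QGA
    }
    where
    open Reasoning
    module C′ = MK.IsBasisProperties {v = G′} C′-basis
    module C = MK.IsBasisProperties {v = G} C-basis
    preimage : ∀ i → ∃[ v ] v ∈ C × v ⊙ A ≈ᵛ G′ i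
    preimage i = C′⊆ (C′.∈-basis i)
    Q : Matrixᵏ k k
    Q i = proj₁ (message C-basis (proj₁ (proj₂ (preimage i))))
    G′≋QGA : G′ ≋ Q · (G · ιᴹ A)
    G′≋QGA i = begin
      G′ i                  ≈⟨ proj₂ (proj₂ (preimage i)) ⟨
      proj₁ (preimage i) ⊙ A ≈⟨ ⊙-cong A (proj₂ (message C-basis (proj₁ (proj₂ (preimage i))))) ⟨
      (Q i ·ᵛ G) ⊙ A        ≈⟨ Kᴹ.·ᵛ-assoc (Q i) G (ιᴹ A) ⟩
      Q i ·ᵛ (G · ιᴹ A)     ∎
    GA∈C′ : ∀ i → G i ⊙ A ∈ C′
    GA∈C′ i = ⊆C′ (G i , C.∈-basis i , λ _ → K.refl)
    P : Matrixᵏ k k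
    P i = proj₁ (message C′-basis (GA∈C′ i))
    PG′≋GA : P · G′ ≋ G · ιᴹ A
    PG′≋GA i = proj₂ (message C′-basis (GA∈C′ i))

  module _ {C C′ : Pred (Vector K.Carrier n) 0ℓ} {G G′ : Matrixᵏ k n}
           (C-basis : K^n.IsBasis C G) (C′-basis : K^n.IsBasis C′ G′) (related : Related G G′) where
    open Related related

    Related⇒CodeEquivalent : CodeEquivalent C C′
    Related⇒CodeEquivalent = B , (B⁻ , B⁻B≋1 , BB⁻≋1) ,
      (λ {w} w∈C′ → let (x , xG′≈w) = message C′-basis w∈C′ in
         (x ·ᵛ Q) ·ᵛ G , ·ᵛ∈ C-basis (x ·ᵛ Q) , ≈ᵛ-trans (≈ᵛ-sym (·ᵛ-G′ x)) xG′≈w) ,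
      (λ {w} (v , v∈C , vB≈w) → let (x , xG≈v) = message C-basis v∈C in
         proj₁ (proj₂ C′-basis) (LK.·ᵛ⇒∈⟨⟩ {A = G′} (x ·ᵛ Q⁻) (begin
           (x ·ᵛ Q⁻) ·ᵛ G′                 ≈⟨ ·ᵛ-G′ (x ·ᵛ Q⁻) ⟩
           (((x ·ᵛ Q⁻) ·ᵛ Q) ·ᵛ G) ⊙ B     ≈⟨ ⊙-cong B (PK.·ᵛ-congˡ G (LK.·-1ʳ x Q⁻ Q Q⁻Q≋1)) ⟩
           (x ·ᵛ G) ⊙ B                    ≈⟨ ⊙-cong B xG≈v ⟩
           v ⊙ B                           ≈⟨ vB≈w ⟩
           w                               ∎)))
      where
      open Reasoning
      ·ᵛ-G′ : ∀ x → x ·ᵛ G′ ≈ᵛ ((x ·ᵛ Q) ·ᵛ G) ⊙ B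
      ·ᵛ-G′ x = begin
        x ·ᵛ G′                      ≈⟨ PK.·ᵛ-congʳ x G′≋QGB ⟩
        x ·ᵛ (Q · (G · ιᴹ B))        ≈⟨ Kᴹ.·ᵛ-assoc x Q (G · ιᴹ B) ⟨
        (x ·ᵛ Q) ·ᵛ (G · ιᴹ B)       ≈⟨ Kᴹ.·ᵛ-assoc (x ·ᵛ Q) G (ιᴹ B) ⟨
        ((x ·ᵛ Q) ·ᵛ G) ⊙ B          ∎

  module _ {S S′ : Pred (Vector K.Carrier k) 0ℓ} {G G′ : Matrixᵏ k n}
           (S-basis : K^n/F.IsBasis S (transpose G)) (S′-basis : K^n/F.IsBasis S′ (transpose G′)) where
    private
      module S = MK/F.IsBasisProperties {v = transpose G} S-basis
      module S′ = MK/F.IsBasisProperties {v = transpose G′} S′-basis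
      open Columns G using (col; col≈)
      open Columns G′ using () renaming (col to col′; col≈ to col′≈)

    -- Elements of a system are row vectors here, so the relation is read transposed: `transpose Q`
    -- is the automorphism and `transpose B` changes the F-coordinates.
    Related⇒SystemEquivalent : Related G G′ → SystemEquivalent S S′
    Related⇒SystemEquivalent related = (_·ᵛ transpose Q) ,
      LK.·ᵛ-isIso (LK.transpose-·-≋1 Q⁻ Q Q⁻Q≋1) (LK.transpose-·-≋1 Q Q⁻ QQ⁻≋1) ,
      (λ {y} (x , x∈S , xQ≈y) →
        let a = S.coords x∈S in
        proj₁ (proj₂ S′-basis) (a Fᴹ.·ᵛ transpose B⁻ , (begin
          col′ (a Fᴹ.·ᵛ transpose B⁻)
            ≈⟨ col′-col (a Fᴹ.·ᵛ transpose B⁻) ⟩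
          col ((a Fᴹ.·ᵛ transpose B⁻) Fᴹ.·ᵛ transpose B) ·ᵛ transpose Q
            ≈⟨ PK.·ᵛ-congˡ (transpose Q) (MK/F.lincomb-congˡ (transpose G)
                 (LF.·-1ʳ a (transpose B⁻) (transpose B) (LF.transpose-·-≋1 B B⁻ BB⁻≋1))) ⟩
          col a ·ᵛ transpose Q
            ≈⟨ PK.·ᵛ-congˡ (transpose Q) (S.lincomb-coords x∈S) ⟩
          x ·ᵛ transpose Q
            ≈⟨ xQ≈y ⟩
          y ∎))) ,
      (λ {y} y∈S′ → let a = S′.coords y∈S′ in
        col (a Fᴹ.·ᵛ transpose B) , S.lincomb∈ (a Fᴹ.·ᵛ transpose B) ,
        ≈ᵛ-trans (≈ᵛ-sym (col′-col a)) (S′.lincomb-coords y∈S′))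
      where
      open Related related
      open Reasoning
      G′ᵀ : transpose G′ ≋ (ιᴹ (transpose B) · transpose G) · transpose Q
      G′ᵀ j i = K.trans (G′≋QGB i j) (K.trans (LK.transpose-· Q (G · ιᴹ B) j i)
        (PK.·ᵛ-congˡ (transpose Q) (LK.transpose-· G (ιᴹ B) j) i))
      col′-col : ∀ a → col′ a ≈ᵛ col (a Fᴹ.·ᵛ transpose B) ·ᵛ transpose Q
      col′-col a = begin
        col′ a
          ≈⟨ col′≈ a ⟩
        ιᵛ a ·ᵛ transpose G′
          ≈⟨ PK.·ᵛ-congʳ (ιᵛ a) G′ᵀ ⟩
        ιᵛ a ·ᵛ ((ιᴹ (transpose B) · transpose G) · transpose Q)
          ≈⟨ Kᴹ.·ᵛ-assoc (ιᵛ a) (ιᴹ (transpose B) · transpose G) (transpose Q) ⟨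
        (ιᵛ a ·ᵛ (ιᴹ (transpose B) · transpose G)) ·ᵛ transpose Q
          ≈⟨ PK.·ᵛ-congˡ (transpose Q) (Kᴹ.·ᵛ-assoc (ιᵛ a) (ιᴹ (transpose B)) (transpose G)) ⟨
        ((ιᵛ a ·ᵛ ιᴹ (transpose B)) ·ᵛ transpose G) ·ᵛ transpose Q
          ≈⟨ PK.·ᵛ-congˡ (transpose Q) (PK.·ᵛ-congˡ (transpose G) (ιᵛ-·ᵛ a (transpose B))) ⟨
        (ιᵛ (a Fᴹ.·ᵛ transpose B) ·ᵛ transpose G) ·ᵛ transpose Q
          ≈⟨ PK.·ᵛ-congˡ (transpose Q) (col≈ (a Fᴹ.·ᵛ transpose B)) ⟨
        col (a Fᴹ.·ᵛ transpose B) ·ᵛ transpose Q ∎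

    -- A K-linear `f` commutes with F-combinations, read as K-combinations with coefficients in the
    -- image of `ι`. Hence the coordinate matrices `a` and `b` of the two F-bases are inverse to
    -- each other, while `f` itself is the matrix `M` of its values on unit vectors.
    SystemEquivalent⇒Related : SystemEquivalent S S′ → Related G G′
    SystemEquivalent⇒Related (f , iso , fS⊆ , ⊆fS) = record
      { Q = transpose M ; Q⁻ = transpose M⁻ ; B = transpose b ; B⁻ = transpose a
      ; QQ⁻≋1 = LK.transpose-·-≋1 M⁻ M M⁻M≋1
      ; Q⁻Q≋1 = LK.transpose-·-≋1 M M⁻ MM⁻≋1
      ; BB⁻≋1 = LF.transpose-·-≋1 a b ab≋1
      ; B⁻B≋1 = LF.transpose-·-≋1 b a ba≋1
      ; G′≋QGB = G′≋MᵀGbᵀ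
      }
      where
      open Reasoning
      module f = K^n.IsLeftModuleIsomorphism iso
      g = proj₁ (K^n.isIso-inverse iso)
      gIso = proj₁ (proj₂ (K^n.isIso-inverse iso))
      gf = proj₂ (proj₂ (K^n.isIso-inverse iso))
      module g = K^n.IsLeftModuleIsomorphism gIso
      fg : ∀ y → f (g y) ≈ᵛ y
      fg y = g.injective (gf (g y))

      matrixOf : (Vector K.Carrier k → Vector K.Carrier k) → Matrixᵏ k k
      matrixOf h i = h (Kᴹ.1ᴹ i)
      ·ᵛ-matrixOf : ∀ {h} → K^n.IsLeftModuleIsomorphism h → ∀ x → x ·ᵛ matrixOf h ≈ᵛ h x
      ·ᵛ-matrixOf {h} h-iso x = begin
        x ·ᵛ matrixOf h              ≈⟨ LK.lincomb≈·ᵛ x (matrixOf h) ⟨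
        K^n.lincomb x (matrixOf h)   ≈⟨ MK.isIso-lincomb h-iso x Kᴹ.1ᴹ ⟨
        h (K^n.lincomb x Kᴹ.1ᴹ)      ≈⟨ h.⟦⟧-cong (LK.lincomb≈·ᵛ x Kᴹ.1ᴹ) ⟩
        h (x ·ᵛ Kᴹ.1ᴹ)               ≈⟨ h.⟦⟧-cong (Kᴹ.·ᵛ-identityʳ x) ⟩
        h x                          ∎
        where module h = K^n.IsLeftModuleIsomorphism h-iso
      M = matrixOf f
      M⁻ = matrixOf g
      MM⁻≋1 : M · M⁻ ≋ Kᴹ.1ᴹ
      MM⁻≋1 i = ≈ᵛ-trans (·ᵛ-matrixOf gIso (M i)) (gf (Kᴹ.1ᴹ i))
      M⁻M≋1 : M⁻ · M ≋ Kᴹ.1ᴹ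
      M⁻M≋1 i = ≈ᵛ-trans (·ᵛ-matrixOf iso (M⁻ i)) (fg (Kᴹ.1ᴹ i))

      preimage : ∀ l → ∃[ x ] x ∈ S × f x ≈ᵛ transpose G′ l
      preimage l = ⊆fS (S′.∈-basis l)
      a b : Matrixᶠ n n
      a j = S′.coords (fS⊆ (transpose G j , S.∈-basis j , λ _ → K.refl))
      b l = S.coords (proj₁ (proj₂ (preimage l)))
      col′-a : ∀ j → col′ (a j) ≈ᵛ f (transpose G j)
      col′-a j = S′.lincomb-coords (fS⊆ (transpose G j , S.∈-basis j , λ _ → K.refl))
      f-col-b : ∀ l → f (col (b l)) ≈ᵛ transpose G′ l
      f-col-b l = ≈ᵛ-trans (f.⟦⟧-cong (S.lincomb-coords (proj₁ (proj₂ (preimage l)))))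
        (proj₂ (proj₂ (preimage l)))

      ba≋1 : b Fᴹ.· a Fᴹ.≋ Fᴹ.1ᴹ
      ba≋1 l = MK/F.lincomb-injective {v = transpose G′} S′.independent (b l Fᴹ.·ᵛ a) (Fᴹ.1ᴹ l) (begin
        col′ (b l Fᴹ.·ᵛ a)                             ≈⟨ MK/F.lincomb-·ᵛ (b l) a (transpose G′) ⟩
        K^n/F.lincomb (b l) (λ j → col′ (a j))         ≈⟨ MK/F.lincomb-congʳ (b l) col′-a ⟩
        K^n/F.lincomb (b l) (λ j → f (transpose G j))  ≈⟨ MK.isIso-lincomb iso (ιᵛ (b l)) (transpose G) ⟨
        f (col (b l))                                  ≈⟨ f-col-b l ⟩
        transpose G′ l                                 ≈⟨ MK/F.lincomb-1ᴹ l (transpose G′) ⟨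
        col′ (Fᴹ.1ᴹ l)                                 ∎)

      ab≋1 : a Fᴹ.· b Fᴹ.≋ Fᴹ.1ᴹ
      ab≋1 j = MK/F.lincomb-injective {v = transpose G} S.independent (a j Fᴹ.·ᵛ b) (Fᴹ.1ᴹ j)
        (f.injective (begin
          f (col (a j Fᴹ.·ᵛ b))                           ≈⟨ f.⟦⟧-cong (MK/F.lincomb-·ᵛ (a j) b (transpose G)) ⟩
          f (K^n/F.lincomb (a j) (λ l → col (b l)))       ≈⟨ MK.isIso-lincomb iso (ιᵛ (a j)) (λ l → col (b l)) ⟩
          K^n/F.lincomb (a j) (λ l → f (col (b l)))       ≈⟨ MK/F.lincomb-congʳ (a j) f-col-b ⟩
          col′ (a j)                                      ≈⟨ col′-a j ⟩
          f (transpose G j)                               ≈⟨ f.⟦⟧-cong (MK/F.lincomb-1ᴹ j (transpose G)) ⟨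
          f (col (Fᴹ.1ᴹ j))                               ∎))

      G′ᵀ : transpose G′ ≋ ιᴹ b · (transpose G · M)
      G′ᵀ l = begin
        transpose G′ l                       ≈⟨ f-col-b l ⟨
        f (col (b l))                        ≈⟨ ·ᵛ-matrixOf iso (col (b l)) ⟨
        col (b l) ·ᵛ M                       ≈⟨ PK.·ᵛ-congˡ M (col≈ (b l)) ⟩
        (ιᵛ (b l) ·ᵛ transpose G) ·ᵛ M       ≈⟨ Kᴹ.·ᵛ-assoc (ιᵛ (b l)) (transpose G) M ⟩
        ιᵛ (b l) ·ᵛ (transpose G · M)        ∎

      G′≋MᵀGbᵀ : G′ ≋ transpose M · (G · ιᴹ (transpose b))
      G′≋MᵀGbᵀ i = begin
        G′ i
          ≈⟨ (λ j → G′ᵀ j i) ⟩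
        transpose (ιᴹ b · (transpose G · M)) i
          ≈⟨ LK.transpose-· (ιᴹ b) (transpose G · M) i ⟩
        transpose (transpose G · M) i ·ᵛ ιᴹ (transpose b)
          ≈⟨ PK.·ᵛ-congˡ (ιᴹ (transpose b)) (LK.transpose-· (transpose G) M i) ⟩
        (transpose M i ·ᵛ G) ·ᵛ ιᴹ (transpose b)
          ≈⟨ Kᴹ.·ᵛ-assoc (transpose M i) G (ιᴹ (transpose b)) ⟩
        transpose M i ·ᵛ (G · ιᴹ (transpose b)) ∎

  -- Codes and systems sharing a matrix, and the correspondence

  -- Both maps choose partners in this one relation. Their well-definedness on classes and both
  -- inverse laws are therefore instances of transferring an equivalence between two associated
  -- pairs.
  Associated : Pred (Vector K.Carrier n) 0ℓ → Pred (Vector K.Carrier k) 0ℓ → Set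
  Associated {n} {k} C S = Σ[ G ∈ Matrixᵏ k n ] K^n.IsBasis C G × K^n/F.IsBasis S (transpose G)

  module _ {C C′ : Pred (Vector K.Carrier n) 0ℓ} {S S′ : Pred (Vector K.Carrier k) 0ℓ} where

    associated-systems : Associated C S → Associated C′ S′ → CodeEquivalent C C′ → SystemEquivalent S S′
    associated-systems (G , C-basis , S-basis) (G′ , C′-basis , S′-basis) C∼C′ =
      Related⇒SystemEquivalent {G = G} {G′} S-basis S′-basis (CodeEquivalent⇒Related C-basis C′-basis C∼C′)

    associated-codes : Associated C S → Associated C′ S′ → SystemEquivalent S S′ → CodeEquivalent C C′
    associated-codes (G , C-basis , S-basis) (G′ , C′-basis , S′-basis) S∼S′ =
      Related⇒CodeEquivalent C-basis C′-basis (SystemEquivalent⇒Related {G = G} {G′} S-basis S′-basis S∼S′)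

  module Correspondence (n k d : ℕ) .{{_ : NonZero k}} where

    Φ-basis : ((C , _) : NondegenerateCode n k d) → let (G , _) = Code.dimension C in
              K^n/F.IsBasis K^n/F.⟨ transpose G ⟩ (transpose G)
    Φ-basis (C , nondegenerate) =
      nondegenerate⇒independent (proj₂ (Code.dimension C)) nondegenerate , (λ x → x) , (λ x → x)

    Φ : NondegenerateCode n k d → System n k d
    Φ (C , nondegenerate) = record
      { carrier = K^n/F.⟨ transpose G ⟩
      ; isSubspace = MK/F.⟨⟩-isSubspace (transpose G)
      ; dimension = transpose G , S-basis
      ; spanning = columns-span C-basis
      ; distance = minimumRank⇒distance C-basis S-basis (Code.minimumRank C)
      }
      where
      G = proj₁ (Code.dimension C)
      C-basis = proj₂ (Code.dimension C)
      S-basis = Φ-basis (C , nondegenerate)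

    Φ-associated : ∀ C → Associated (Code.carrier (proj₁ C)) (System.carrier (Φ C))
    Φ-associated C = proj₁ (Code.dimension (proj₁ C)) , proj₂ (Code.dimension (proj₁ C)) , Φ-basis C

    Ψ-basis : (S : System n k d) → let (W , _) = System.dimension S in
              K^n.IsBasis K^n.⟨ transpose W ⟩ (transpose W)
    Ψ-basis S = spanning⇒independent {G = transpose (proj₁ (System.dimension S))}
      (proj₂ (System.dimension S)) (System.spanning S) , (λ x → x) , (λ x → x)

    Ψ : System n k d → NondegenerateCode n k d
    Ψ S = record
      { carrier = K^n.⟨ G ⟩
      ; isSubspace = MK.⟨⟩-isSubspace G
      ; dimension = G , C-basis
      ; minimumRank = distance⇒minimumRank C-basis S-basis (System.distance S)
      } , independent⇒nondegenerate C-basis (proj₁ S-basis)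
      where
      G = transpose (proj₁ (System.dimension S))
      C-basis = Ψ-basis S
      S-basis = proj₂ (System.dimension S)

    Ψ-associated : ∀ S → Associated (Code.carrier (proj₁ (Ψ S))) (System.carrier S)
    Ψ-associated S = transpose (proj₁ (System.dimension S)) , Ψ-basis S , proj₂ (System.dimension S)

    -- Another generator matrix associates the same code with the span of its own columns,
    -- independent by nondegeneracy; the identity equivalence of the code is then transferred to the
    -- systems.
    Φ-isΦ : IsΦ Φ
    Φ-isΦ C G G-basis = associated-systems
      (G , G-basis , nondegenerate⇒independent G-basis (proj₂ C) , (λ x → x) , (λ x → x))
      (Φ-associated C) (≈C-refl {C = proj₁ C})

    Ψ-isΨ : IsΨ Ψ
    Ψ-isΨ S G G-basis = associated-codes
      (G , (spanning⇒independent {G = G} G-basis (System.spanning S) , (λ x → x) , (λ x → x)) , G-basis)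
      (Ψ-associated S) (≈S-refl {S = S})

    Φ-cutting : ∀ C → Minimal (proj₁ C) → CuttingBlockingSet (Φ C)
    Φ-cutting C = let (G , C-basis , S-basis) = Φ-associated C in minimal⇒cutting C-basis S-basis

    Ψ-minimal : ∀ S → CuttingBlockingSet S → Minimal (proj₁ (Ψ S))
    Ψ-minimal S = let (G , C-basis , S-basis) = Ψ-associated S in cutting⇒minimal C-basis S-basis

    Φ-cong : ∀ {C C′} → proj₁ C ≈C proj₁ C′ → Φ C ≈S Φ C′
    Φ-cong {C} {C′} = associated-systems (Φ-associated C) (Φ-associated C′)

    Ψ-cong : ∀ {S S′} → S ≈S S′ → proj₁ (Ψ S) ≈C proj₁ (Ψ S′)
    Ψ-cong {S} {S′} = associated-codes (Ψ-associated S) (Ψ-associated S′)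

    Φ-inverseˡ : ∀ {S C} → proj₁ C ≈C proj₁ (Ψ S) → Φ C ≈S S
    Φ-inverseˡ {S} {C} = associated-systems (Φ-associated C) (Ψ-associated S)

    Φ-inverseʳ : ∀ {C S} → S ≈S Φ C → proj₁ (Ψ S) ≈C proj₁ C
    Φ-inverseʳ {C} {S} = associated-codes (Ψ-associated S) (Φ-associated C)

    ΦΨ : Inverse (nondegenerateCodes n k d) (systems n k d)
    ΦΨ = record
      { to = Φ
      ; from = Ψ
      ; to-cong = λ {C} {C′} → Φ-cong {C} {C′}
      ; from-cong = λ {S} {S′} → Ψ-cong {S} {S′}
      ; inverse = (λ {S} {C} → Φ-inverseˡ {S} {C}) , (λ {C} {S} → Φ-inverseʳ {C} {S})
      }

    restricted : Inverse (minimalCodes n k d) (cuttingSystems n k d)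
    restricted = record
      { to = λ (C , minimal) → Φ C , Φ-cutting C minimal
      ; from = λ (S , cutting) → Ψ S , Ψ-minimal S cutting
      ; to-cong = λ {(C , _)} {(C′ , _)} → Φ-cong {C} {C′}
      ; from-cong = λ {(S , _)} {(S′ , _)} → Ψ-cong {S} {S′}
      ; inverse = (λ {(S , _)} {(C , _)} → Φ-inverseˡ {S} {C}) , (λ {(C , _)} {(S , _)} → Φ-inverseʳ {C} {S})
      }

corollary5p7 : ∀ {q m : ℕ} → PrimePower q → .{{_ : NonZero m}} →
    (E : FieldExtension q m) (Γ : OrderedBasis E) →
    (n k d : ℕ) .{{_ : NonZero n}} .{{_ : NonZero k}} .{{_ : NonZero d}} →
    let open RankMetric E Γ in
    let module Codes = Setoid (nondegenerateCodes n k d) in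
    let module Systems = Setoid (systems n k d) in
    Σ[ ΦΨ ∈ Inverse (nondegenerateCodes n k d) (systems n k d) ]
    IsΦ (Inverse.to ΦΨ) × IsΨ (Inverse.from ΦΨ) ×
    (Σ[ restricted ∈ Inverse (minimalCodes n k d) (cuttingSystems n k d) ]
    (∀ C → proj₁ (Inverse.to restricted C) Systems.≈ Inverse.to ΦΨ (proj₁ C)) ×
    (∀ S → proj₁ (Inverse.from restricted S) Codes.≈ Inverse.from ΦΨ (proj₁ S)))
corollary5p7 _ E Γ n k d =
  ΦΨ , Φ-isΦ , Ψ-isΨ , restricted ,
  -- The restricted maps act on representatives by `Φ` and `Ψ` themselves, so agreement is
  -- reflexivity.
  (λ C → Setoid.refl (systems n k d) {Φ (proj₁ C)}) ,
  (λ S → Setoid.refl (nondegenerateCodes n k d) {Ψ (proj₁ S)})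
  where
  open RankMetric E Γ using (systems; nondegenerateCodes)
  open RankMetricProperties.Correspondence E Γ n k d
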